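{- Let $p>7408848$ be a prime. Let $\mathcal{P}$ be the set of polynomials $P\in\mathbb{F}_p[x]$ of degree exactly $\frac{p-1}{2}$ whose range sum equals $p$, i.e. $\sum_{x\in\mathbb{F}_p}P(x)=p$, where each value $P(x)$ is regarded as an integer in $\{0,1,\dots,p-1\}$ and the sum is computed in $\mathbb{Z}$. Then $$\mathcal{P}=\Big\{\varepsilon (x-a)^{\frac{p-1}{2}}+1 \;:\; a\in\mathbb{F}_p,\ \varepsilon\in\{1,-1\}\Big\}\ \cup\ \Big\{\tfrac{p+1}{2}\big(\varepsilon (x-a)^{\frac{p-1}{2}}+1\big) \;:\; a\in\mathbb{F}_p,\ \varepsilon\in\{1,-1\}\Big\}.$$ Equivalently, up to affine substitutions $x\mapsto \alpha x+\beta$ ($\alpha,\beta\in\mathbb{F}_p$, $\alpha\neq 0$), there are exactly two polynomials in $\mathcal{P}$, namely $x^{\frac{p-1}{2}}+1$ and $\frac{p+1}{2}\big(x^{\frac{p-1}{2}}+1\big)$.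
   Context: Elements of $\mathbb{F}_p$ are identified with the integers $\{0,1,\dots,p-1\}$; in the coefficients, $\frac{p+1}{2}$ and $\pm1$ denote the corresponding elements of $\mathbb{F}_p$. -}

module Defs where

open import Data.Nat using (ℕ; zero; suc; _+_; _*_; _∸_; _/_; _%_; NonZero)
open import Data.Fin using (Fin; toℕ; fromℕ)
open import Data.List using (List; []; _∷_; map; foldr; upTo; tabulate)
open import Data.Nat.ListAction using (sum)
open import Data.Product using (Σ; _×_)
open import Data.Sum using (_⊎_)
open import Relation.Binary.PropositionalEquality using (_≡_; _≢_)

-- Polynomials with natural-number coefficients, as coefficient lists
-- (constant term first).  Elements of F_p are represented by naturals;
-- all reductions mod p are done at the very end (reduction mod p is a
-- ring homomorphism ℕ[x] → F_p[x]).
Poly : Set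
Poly = List ℕ

_⊕_ : Poly → Poly → Poly
[] ⊕ g = g
(a ∷ f) ⊕ [] = a ∷ f
(a ∷ f) ⊕ (b ∷ g) = (a + b) ∷ (f ⊕ g)

scale : ℕ → Poly → Poly
scale c = map (c *_)

_⊗_ : Poly → Poly → Poly
[] ⊗ g = []
(a ∷ f) ⊗ g = scale a g ⊕ (0 ∷ (f ⊗ g))

pow : Poly → ℕ → Poly
pow f zero = 1 ∷ []
pow f (suc n) = f ⊗ pow f n

coeff : Poly → ℕ → ℕ
coeff [] k = 0
coeff (a ∷ f) zero = a
coeff (a ∷ f) (suc k) = coeff f k

evalℕ : Poly → ℕ → ℕ
evalℕ f x = foldr (λ a acc → a + x * acc) 0 f

half : ℕ → ℕ
half p = (p ∸ 1) / 2

-- A polynomial over F_p of degree ≤ (p-1)/2, given by its coefficients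
-- c_0, …, c_{(p-1)/2} ∈ F_p = Fin p.
CoeffsFp : ℕ → Set
CoeffsFp p = Fin (suc (half p)) → Fin p

toPoly : {p : ℕ} → CoeffsFp p → Poly
toPoly {p} c = tabulate (λ i → toℕ (c i))

HasDegreeHalf : {p : ℕ} → CoeffsFp p → Set
HasDegreeHalf {p} c = toℕ (c (fromℕ (half p))) ≢ 0

rangeSum : (p : ℕ) .{{_ : NonZero p}} → Poly → ℕ
rangeSum p f = sum (map (λ x → evalℕ f x % p) (upTo p))

InCalP : (p : ℕ) .{{_ : NonZero p}} → CoeffsFp p → Set
InCalP p c = HasDegreeHalf c × rangeSum p (toPoly c) ≡ p

_≈ₚ_ : {p : ℕ} .{{_ : NonZero p}} → CoeffsFp p → Poly → Set
_≈ₚ_ {p} c g = (k : ℕ) → coeff (toPoly c) k ≡ coeff g k % p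

-- ε (x - a)^{(p-1)/2} + 1, with x - a = (p - a) + x and ε ∈ ℕ
basePoly : (p : ℕ) → Fin p → ℕ → Poly
basePoly p a ε = scale ε (pow ((p ∸ toℕ a) ∷ 1 ∷ []) (half p)) ⊕ (1 ∷ [])

IsSign : ℕ → ℕ → Set
IsSign p ε = (ε ≡ 1) ⊎ (ε ≡ p ∸ 1)

InRHS : (p : ℕ) .{{_ : NonZero p}} → CoeffsFp p → Set
InRHS p c =
  (Σ (Fin p) λ a → Σ ℕ λ ε → IsSign p ε × (c ≈ₚ basePoly p a ε))
  ⊎ (Σ (Fin p) λ a → Σ ℕ λ ε → IsSign p ε × (c ≈ₚ scale ((p + 1) / 2) (basePoly p a ε)))

-- Write p = 2m + 1 and let F be the product of (X - x)^f(x) over x in F_p, where f(x) is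
-- taken in {0, …, p - 1}; it is monic of degree p.  With D = X^p - X, interpolation turns
-- the logarithmic derivative of F into F′D = -fF, so F′ has degree at most m and
-- h = F - D has degree at most m + 1.  Then (F′ + f)F = F′h, and comparing degrees shows
-- that F′ + f is a constant s.  Hence sD = -fh and, differentiating, f′h = (f - 1)(f - s):
-- f takes only the values 0, 1, s on F_p, and h vanishes at the at least m + 1 points where
-- f does not.  Differentiating once more at such a point, f′ vanishes there unless f = s = 2
-- or f = 1 = 2s; as f′ cannot vanish at all of them, s = 2 or 2s = 1.  The local form of the
-- equation at a point a with f(a) = 1 (respectively f(a) = s) then forces f - f(a) to be a
-- multiple of (X - a)^m.  Conversely, x^m is 1 at most m times and -1 at most m times on F_p,
-- hence exactly m times each, which determines the sum of the values.
module Submission where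

open import Defs
open import Algebra.Bundles using (CommutativeSemiring; CommutativeMonoid)
import Algebra.Properties.CommutativeSemigroup as CommutativeSemigroupProperties
import Algebra.Solver.Ring.NaturalCoefficients.Default as SemiringSolver
open import Data.Fin as Fin using (Fin; toℕ; fromℕ; fromℕ<)
open import Data.Fin.Properties using (toℕ-fromℕ; toℕ-fromℕ<; toℕ<n)
open import Data.List
  using (List; []; _∷_; map; length; upTo; replicate; concatMap; _++_; filter; tabulate)
open import Data.List.Membership.Propositional using (_∈_; find; lose)
open import Data.List.Membership.Propositional.Properties using (∈-upTo⁻)
open import Data.List.Properties
  using (length-++; length-replicate; length-upTo; length-tabulate; filter-accept; filter-reject)
open import Data.List.Relation.Unary.All as All using (All; []; _∷_)
import Data.List.Relation.Unary.All.Properties as All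
open import Data.List.Relation.Unary.AllPairs using (AllPairs; []; _∷_)
import Data.List.Relation.Unary.AllPairs.Properties as AllPairs
open import Data.List.Relation.Unary.Any as Any using (here; there)
open import Data.Nat
open import Data.Nat.Divisibility
open import Data.Nat.DivMod
open import Data.Nat.ListAction using (sum)
open import Data.Nat.Primality using (Prime; euclidsLemma; prime⇒irreducible; prime⇒nonTrivial)
open import Data.Nat.Properties
open import Data.Nat.Tactic.RingSolver using (solve-∀)
open import Data.Product using (Σ; _×_; _,_; proj₁; proj₂; ∃)
open import Data.Sum as Sum using (_⊎_; inj₁; inj₂; [_,_]′)
open import Data.Unit using (tt)
open import Function.Base using (_∘_; id)
open import Function.Bundles using (_⇔_; mk⇔)
open import Level using (0ℓ)
open import Relation.Binary.Definitions using (tri<; tri≈; tri>)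
open import Relation.Binary.PropositionalEquality
  using (_≡_; _≢_; refl; sym; trans; cong; cong₂; subst; ≢-sym)
open import Relation.Binary.Structures using (IsEquivalence)
open import Relation.Nullary using (¬_; ¬?; Dec; yes; no; contradiction)

-- The range sum is used twice. It is the degree of F: for the sum p, F and D are both monic of
-- degree p and cancel at the top, and because F' has degree at most m, the coefficients of F
-- strictly between m + 1 and p vanish as well. Then F'h has degree at most m + (m + 1) = p, exactly
-- the degree of F, which leaves no room for a nonconstant F' + f. It also produces the point a. If
-- s = 2 and f never took the value 1, the sum would be even, whereas p is odd. If 2s = 1 and f
-- never took the value s, then p values, each 0 or 1, would have sum p, and f would be the constant
-- 1. The two exceptional s come from the differentiated equation, which at a zero of h reads (2s +
-- 2)f' = 3ff'. The exponent m comes from the local equation: if f - f(a) = (X - a)^j q, it gives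
-- (2j + 1)q(a) = 0, and 2j + 1 is invertible as long as 2j + 1 < p = 2m + 1, that is j < m. What
-- remains is f = β(X - a)^m + f(a), and the value at a + 1 determines β up to sign.

-- Counting and summing over lists

length-filter-¬ : ∀ {A : Set} {P : A → Set} (P? : ∀ x → Dec (P x)) xs →
  length (filter P? xs) + length (filter (¬? ∘ P?) xs) ≡ length xs
length-filter-¬ P? [] = refl
length-filter-¬ P? (x ∷ xs) with P? x
... | yes _ = cong suc (length-filter-¬ P? xs)
... | no _ = trans (+-suc _ _) (cong suc (length-filter-¬ P? xs))

∣-sum-map : ∀ {A : Set} d (v : A → ℕ) xs → All (λ x → d ∣ v x) xs → d ∣ sum (map v xs)
∣-sum-map d v [] [] = d ∣0
∣-sum-map d v (x ∷ xs) (dx ∷ dxs) = ∣m∣n⇒∣m+n dx (∣-sum-map d v xs dxs)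

sum-map≤length : ∀ {A : Set} (v : A → ℕ) xs → All (λ x → v x ≤ 1) xs → sum (map v xs) ≤ length xs
sum-map≤length v [] [] = z≤n
sum-map≤length v (x ∷ xs) (le ∷ les) = +-mono-≤ le (sum-map≤length v xs les)

-- A single 0 would leave the sum short of the length. Used to exclude that f takes only the values
-- 0 and 1.
sum-map≡length⇒≡1 : ∀ {A : Set} (v : A → ℕ) xs → All (λ x → v x ≤ 1) xs →
  sum (map v xs) ≡ length xs → All (λ x → v x ≡ 1) xs
sum-map≡length⇒≡1 v [] [] _ = []
sum-map≡length⇒≡1 v (x ∷ xs) (le ∷ les) e with v x in vx≡
sum-map≡length⇒≡1 v (x ∷ xs) (le ∷ les) e | zero =
  contradiction e (<⇒≢ (s≤s (sum-map≤length v xs les)))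
sum-map≡length⇒≡1 v (x ∷ xs) (le ∷ les) e | suc zero =
  vx≡ ∷ sum-map≡length⇒≡1 v xs les (suc-injective e)
sum-map≡length⇒≡1 v (x ∷ xs) (s≤s () ∷ les) e | suc (suc _)

module _ {A : Set} (v : A → ℕ) where

  #_ : ℕ → List A → ℕ
  (# c) xs = length (filter (λ x → v x ≟ c) xs)

  #-accept : ∀ {c x xs} → v x ≡ c → (# c) (x ∷ xs) ≡ suc ((# c) xs)
  #-accept {c} e = cong length (filter-accept (λ x → v x ≟ c) e)

  #-reject : ∀ {c x xs} → v x ≢ c → (# c) (x ∷ xs) ≡ (# c) xs
  #-reject {c} ¬e = cong length (filter-reject (λ x → v x ≟ c) ¬e)

  module _ {a b : ℕ} (a≢b : a ≢ b) (a≢0 : a ≢ 0) (b≢0 : b ≢ 0) where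

    -- Since a, b and 0 are distinct, no entry is counted twice; upper bounds on the three counts
    -- can then be compared with the total.
    length-three-values : ∀ xs → All (λ x → v x ≡ a ⊎ (v x ≡ b ⊎ v x ≡ 0)) xs →
      (# a) xs + ((# b) xs + (# 0) xs) ≡ length xs
    length-three-values [] [] = refl
    length-three-values (x ∷ xs) (inj₁ e ∷ es)
      rewrite #-accept {xs = xs} e | #-reject {xs = xs} (a≢b ∘ trans (sym e))
        | #-reject {xs = xs} (a≢0 ∘ trans (sym e)) = cong suc (length-three-values xs es)
    length-three-values (x ∷ xs) (inj₂ (inj₁ e) ∷ es)
      rewrite #-reject {xs = xs} (≢-sym a≢b ∘ trans (sym e)) | #-accept {xs = xs} e
        | #-reject {xs = xs} (b≢0 ∘ trans (sym e)) =
      trans (+-suc _ _) (cong suc (length-three-values xs es))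
    length-three-values (x ∷ xs) (inj₂ (inj₂ e) ∷ es)
      rewrite #-reject {xs = xs} (≢-sym a≢0 ∘ trans (sym e)) | #-reject {xs = xs} (≢-sym b≢0 ∘ trans (sym e))
        | #-accept {xs = xs} e | +-suc ((# b) xs) ((# 0) xs) | +-suc ((# a) xs) ((# b) xs + (# 0) xs) =
      cong suc (length-three-values xs es)

    sum-three-values : ∀ xs → All (λ x → v x ≡ a ⊎ (v x ≡ b ⊎ v x ≡ 0)) xs →
      sum (map v xs) ≡ (# a) xs * a + (# b) xs * b
    sum-three-values [] [] = refl
    sum-three-values (x ∷ xs) (inj₁ e ∷ es)
      rewrite #-accept {xs = xs} e | #-reject {xs = xs} (a≢b ∘ trans (sym e)) =
      trans (cong₂ _+_ e (sum-three-values xs es)) (sym (+-assoc a _ _))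
    sum-three-values (x ∷ xs) (inj₂ (inj₁ e) ∷ es)
      rewrite #-reject {xs = xs} (≢-sym a≢b ∘ trans (sym e)) | #-accept {xs = xs} e =
      trans (cong₂ _+_ e (sum-three-values xs es)) (lemma b ((# a) xs * a) ((# b) xs * b))
      where
      lemma : ∀ b u w → b + (u + w) ≡ u + (b + w)
      lemma = solve-∀
    sum-three-values (x ∷ xs) (inj₂ (inj₂ e) ∷ es)
      rewrite #-reject {xs = xs} (≢-sym a≢0 ∘ trans (sym e)) | #-reject {xs = xs} (≢-sym b≢0 ∘ trans (sym e)) =
      trans (cong (_+ sum (map v xs)) e) (sum-three-values xs es)

-- Coefficient lists over the naturals

coeff-tabulate : ∀ {n} (g : Fin n → ℕ) i → coeff (tabulate g) (toℕ i) ≡ g i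
coeff-tabulate g Fin.zero = refl
coeff-tabulate g (Fin.suc i) = coeff-tabulate (g ∘ Fin.suc) i

-- `0 < b` covers the indices beyond the end of the list, where `coeff` defaults to 0.
coeff-tabulate-< : ∀ {n b} (g : Fin n → ℕ) → 0 < b → (∀ i → g i < b) → ∀ k → coeff (tabulate g) k < b
coeff-tabulate-< {zero} g 0<b g< k = 0<b
coeff-tabulate-< {suc n} g 0<b g< zero = g< Fin.zero
coeff-tabulate-< {suc n} g 0<b g< (suc k) = coeff-tabulate-< (g ∘ Fin.suc) 0<b (g< ∘ Fin.suc) k

evalℕ-⊕ : ∀ f g x → evalℕ (f ⊕ g) x ≡ evalℕ f x + evalℕ g x
evalℕ-⊕ [] g x = refl
evalℕ-⊕ (a ∷ f) [] x = sym (+-identityʳ _)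
evalℕ-⊕ (a ∷ f) (b ∷ g) x rewrite evalℕ-⊕ f g x = lemma a b x (evalℕ f x) (evalℕ g x)
  where
  lemma : ∀ a b x u v → a + b + x * (u + v) ≡ a + x * u + (b + x * v)
  lemma = solve-∀

evalℕ-scale : ∀ c f x → evalℕ (scale c f) x ≡ c * evalℕ f x
evalℕ-scale c [] x = sym (*-zeroʳ c)
evalℕ-scale c (a ∷ f) x rewrite evalℕ-scale c f x = lemma c a x (evalℕ f x)
  where
  lemma : ∀ c a x u → c * a + x * (c * u) ≡ c * (a + x * u)
  lemma = solve-∀

evalℕ-⊗ : ∀ f g x → evalℕ (f ⊗ g) x ≡ evalℕ f x * evalℕ g x
evalℕ-⊗ [] g x = refl
evalℕ-⊗ (a ∷ f) g x
  rewrite evalℕ-⊕ (scale a g) (0 ∷ (f ⊗ g)) x | evalℕ-scale a g x | evalℕ-⊗ f g x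
  = lemma a (evalℕ g x) x (evalℕ f x)
  where
  lemma : ∀ a v x u → a * v + x * (u * v) ≡ (a + x * u) * v
  lemma = solve-∀

evalℕ-pow : ∀ f n x → evalℕ (pow f n) x ≡ evalℕ f x ^ n
evalℕ-pow f zero x = cong suc (*-zeroʳ x)
evalℕ-pow f (suc n) x = trans (evalℕ-⊗ f (pow f n) x) (cong (evalℕ f x *_) (evalℕ-pow f n x))

coeff-⊕ : ∀ f g k → coeff (f ⊕ g) k ≡ coeff f k + coeff g k
coeff-⊕ [] g k = refl
coeff-⊕ (a ∷ f) [] k = sym (+-identityʳ _)
coeff-⊕ (a ∷ f) (b ∷ g) zero = refl
coeff-⊕ (a ∷ f) (b ∷ g) (suc k) = coeff-⊕ f g k

coeff-scale : ∀ c f k → coeff (scale c f) k ≡ c * coeff f k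
coeff-scale c [] k = sym (*-zeroʳ c)
coeff-scale c (a ∷ f) zero = refl
coeff-scale c (a ∷ f) (suc k) = coeff-scale c f k

-- The product rule for a + X f, which avoids carrying an index; `coeff-der` recovers the usual
-- formula.
der : Poly → Poly
der [] = []
der (a ∷ f) = f ⊕ (0 ∷ der f)

coeff-der : ∀ f k → coeff (der f) k ≡ suc k * coeff f (suc k)
coeff-der [] k = sym (*-zeroʳ k)
coeff-der (a ∷ f) zero = coeff-⊕ f (0 ∷ der f) 0
coeff-der (a ∷ f) (suc k) =
  trans (coeff-⊕ f (0 ∷ der f) (suc k)) (cong (coeff f (suc k) +_) (coeff-der f k))

-- Synthetic division: the coefficients of (f - f(x)) / (X - x).
quot : Poly → ℕ → Poly
quot [] x = []
quot (a ∷ f) x = evalℕ f x ∷ quot f x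

-- The field with p elements

module PrimeField (p : ℕ) .{{_ : NonZero p}} (p-prime : Prime p) where

  infix 4 _≈_ _≉_ _≋_
  infix 8 -_

  -- F_p is ℕ up to congruence modulo p.  The solvers only know commutative semirings, so
  -- identities are arranged without subtraction.
  record _≈_ (a b : ℕ) : Set where
    constructor residue
    field residue≡ : a % p ≡ b % p
  open _≈_

  _≉_ : ℕ → ℕ → Set
  a ≉ b = ¬ (a ≈ b)

  ≡⇒≈ : ∀ {a b} → a ≡ b → a ≈ b
  ≡⇒≈ refl = residue refl

  _≈?_ : ∀ a b → Dec (a ≈ b)
  a ≈? b with a % p ≟ b % p
  ... | yes e = yes (residue e)
  ... | no ¬e = no (¬e ∘ residue≡)

  field-semiring : CommutativeSemiring 0ℓ 0ℓ
  field-semiring = record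
    { Carrier = ℕ ; _≈_ = _≈_ ; _+_ = _+_ ; _*_ = _*_ ; 0# = 0 ; 1# = 1
    ; isCommutativeSemiring = record
      { isSemiring = record
        { isSemiringWithoutAnnihilatingZero = record
          { +-isCommutativeMonoid = record
            { isMonoid = record
              { isSemigroup = record
                { isMagma = record
                  { isEquivalence = ≈-isEquivalence
                  ; ∙-cong = λ { {a} {b} {c} {d} (residue u) (residue v) → residue
                      (trans (%-distribˡ-+ a c p)
                        (trans (cong₂ (λ s t → (s + t) % p) u v) (sym (%-distribˡ-+ b d p)))) } }
                ; assoc = λ a b c → ≡⇒≈ (+-assoc a b c) }
              ; identity = (λ a → ≡⇒≈ refl) , λ a → ≡⇒≈ (+-identityʳ a) }
            ; comm = λ a b → ≡⇒≈ (+-comm a b) }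
          ; *-cong = λ { {a} {b} {c} {d} (residue u) (residue v) → residue
              (trans (%-distribˡ-* a c p)
                (trans (cong₂ (λ s t → (s * t) % p) u v) (sym (%-distribˡ-* b d p)))) }
          ; *-assoc = λ a b c → ≡⇒≈ (*-assoc a b c)
          ; *-identity = (λ a → ≡⇒≈ (*-identityˡ a)) , λ a → ≡⇒≈ (*-identityʳ a)
          ; distrib = (λ a b c → ≡⇒≈ (*-distribˡ-+ a b c)) , λ a b c → ≡⇒≈ (*-distribʳ-+ a b c) }
        ; zero = (λ a → ≡⇒≈ refl) , λ a → ≡⇒≈ (*-zeroʳ a) }
      ; *-comm = λ a b → ≡⇒≈ (*-comm a b) } }
    where
    ≈-isEquivalence : IsEquivalence _≈_
    ≈-isEquivalence = record
      { refl = residue refl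
      ; sym = λ { (residue u) → residue (sym u) }
      ; trans = λ { (residue u) (residue v) → residue (trans u v) } }

  open CommutativeSemiring field-semiring using () renaming
    ( refl to ≈-refl; sym to ≈-sym; trans to ≈-trans; setoid to ≈-setoid
    ; +-cong to +-cong≈; *-cong to *-cong≈ )
  import Relation.Binary.Reasoning.Setoid ≈-setoid as ≈-Reasoning

  +-congˡ≈ : ∀ a {b c} → b ≈ c → a + b ≈ a + c
  +-congˡ≈ a = +-cong≈ {a} ≈-refl

  +-congʳ≈ : ∀ a {b c} → b ≈ c → b + a ≈ c + a
  +-congʳ≈ a e = +-cong≈ e (≈-refl {a})

  *-congˡ≈ : ∀ a {b c} → b ≈ c → a * b ≈ a * c
  *-congˡ≈ a = *-cong≈ {a} ≈-refl

  *-congʳ≈ : ∀ a {b c} → b ≈ c → b * a ≈ c * a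
  *-congʳ≈ a e = *-cong≈ e (≈-refl {a})

  %-≈ : ∀ a → a % p ≈ a
  %-≈ a = residue (m%n%n≡m%n a p)

  suc[p∸1]≡p : suc (p ∸ 1) ≡ p
  suc[p∸1]≡p = suc-pred p

  2≤p : 2 ≤ p
  2≤p = nonTrivial⇒n>1 p {{prime⇒nonTrivial p-prime}}

  0%p≡0 : 0 % p ≡ 0
  0%p≡0 = n∣m⇒m%n≡0 0 p (p ∣0)

  ∣⇒≈0 : ∀ {a} → p ∣ a → a ≈ 0
  ∣⇒≈0 {a} d = residue (trans (n∣m⇒m%n≡0 a p d) (sym 0%p≡0))

  ≈0⇒∣ : ∀ {a} → a ≈ 0 → p ∣ a
  ≈0⇒∣ {a} (residue e) = m%n≡0⇒n∣m a p (trans e 0%p≡0)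

  p≈0 : p ≈ 0
  p≈0 = ∣⇒≈0 ∣-refl

  <p⇒≡ : ∀ {a b} → a < p → b < p → a ≈ b → a ≡ b
  <p⇒≡ a<p b<p (residue e) = trans (sym (m<n⇒m%n≡m a<p)) (trans e (m<n⇒m%n≡m b<p))

  0<·<p⇒≉0 : ∀ {a} → 0 < a → a < p → a ≉ 0
  0<·<p⇒≉0 0<a a<p e = <⇒≢ 0<a (sym (<p⇒≡ a<p (<-trans z<s 2≤p) e))

  1≉0 : 1 ≉ 0
  1≉0 = 0<·<p⇒≉0 z<s 2≤p

  -- Multiplication by p - 1, the representative of -1, needs no bound on a; truncated subtraction
  -- of a from p would.
  -_ : ℕ → ℕ
  - a = (p ∸ 1) * a

  +-inverseʳ : ∀ a → a + - a ≈ 0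
  +-inverseʳ a = ≈-trans (≡⇒≈ (cong (_* a) suc[p∸1]≡p)) (*-congʳ≈ a p≈0)

  +-cancelˡ≈ : ∀ a {b c} → a + b ≈ a + c → b ≈ c
  +-cancelˡ≈ a {b} {c} e = ≈-trans (≈-sym (strip b)) (≈-trans (+-congˡ≈ (- a) e) (strip c))
    where
    strip : ∀ b → - a + (a + b) ≈ b
    strip b = ≈-trans (≡⇒≈ (trans (sym (+-assoc (- a) a b)) (cong (_+ b) (+-comm (- a) a))))
                      (+-congʳ≈ b (+-inverseʳ a))

  integral : ∀ a b → a * b ≈ 0 → a ≈ 0 ⊎ b ≈ 0
  integral a b e with euclidsLemma a b p-prime (≈0⇒∣ e)
  ... | inj₁ d = inj₁ (∣⇒≈0 d)
  ... | inj₂ d = inj₂ (∣⇒≈0 d)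

  integral≉ : ∀ {a b} → a ≉ 0 → a * b ≈ 0 → b ≈ 0
  integral≉ {a} {b} a≉0 e with integral a b e
  ... | inj₁ a≈0 = contradiction a≈0 a≉0
  ... | inj₂ b≈0 = b≈0

  -- The conclusion is a disjunction because the lemma is how factorisations are read off: a(b - c)
  -- = 0 is presented as a·b = a·c.
  *-cancelˡ≈ : ∀ a {b c} → a * b ≈ a * c → a ≈ 0 ⊎ b ≈ c
  *-cancelˡ≈ a {b} {c} e with integral a (b + - c) vanish
    where
    vanish : a * (b + - c) ≈ 0
    vanish = begin
      a * (b + - c)      ≡⟨ *-distribˡ-+ a b (- c) ⟩
      a * b + a * - c    ≈⟨ +-congʳ≈ (a * - c) e ⟩
      a * c + a * - c    ≡⟨ sym (*-distribˡ-+ a c (- c)) ⟩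
      a * (c + - c)      ≈⟨ *-congˡ≈ a (+-inverseʳ c) ⟩
      a * 0              ≡⟨ *-zeroʳ a ⟩
      0                  ∎
      where open ≈-Reasoning
  ... | inj₁ a≈0 = inj₁ a≈0
  ... | inj₂ d = inj₂ (+-cancelˡ≈ (- c) (≈-trans (≡⇒≈ (+-comm (- c) b)) (≈-trans d
                   (≈-trans (≈-sym (+-inverseʳ c)) (≡⇒≈ (+-comm c (- c)))))))

  ^-cong≈ : ∀ {a b} n → a ≈ b → a ^ n ≈ b ^ n
  ^-cong≈ zero e = ≈-refl
  ^-cong≈ (suc n) e = *-cong≈ e (^-cong≈ n e)

  -- Polynomials

  -- Comparing all indices makes trailing zeros of the lists invisible.
  record _≋_ (f g : Poly) : Set where
    constructor coeffs
    field coeff≈ : ∀ k → coeff f k ≈ coeff g k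
  open _≋_

  ≋-refl : ∀ {f} → f ≋ f
  ≋-refl = coeffs λ k → ≈-refl

  ≋-sym : ∀ {f g} → f ≋ g → g ≋ f
  ≋-sym (coeffs u) = coeffs λ k → ≈-sym (u k)

  ≋-trans : ∀ {f g h} → f ≋ g → g ≋ h → f ≋ h
  ≋-trans (coeffs u) (coeffs v) = coeffs λ k → ≈-trans (u k) (v k)

  ⊕-cong : ∀ {f f′ g g′} → f ≋ f′ → g ≋ g′ → f ⊕ g ≋ f′ ⊕ g′
  ⊕-cong {f} {f′} {g} {g′} (coeffs u) (coeffs v) = coeffs λ k →
    ≈-trans (≡⇒≈ (coeff-⊕ f g k)) (≈-trans (+-cong≈ (u k) (v k)) (≡⇒≈ (sym (coeff-⊕ f′ g′ k))))

  ⊕-commutativeMonoid : CommutativeMonoid 0ℓ 0ℓ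
  ⊕-commutativeMonoid = record
    { Carrier = Poly ; _≈_ = _≋_ ; _∙_ = _⊕_ ; ε = []
    ; isCommutativeMonoid = record
      { isMonoid = record
        { isSemigroup = record
          { isMagma = record
            { isEquivalence = record { refl = ≋-refl ; sym = ≋-sym ; trans = ≋-trans }
            ; ∙-cong = ⊕-cong }
          ; assoc = λ f g h → coeffs λ k → ≡⇒≈ (assoc f g h k) }
        ; identity = (λ f → ≋-refl) , λ f → coeffs λ k →
            ≡⇒≈ (trans (coeff-⊕ f [] k) (+-identityʳ _)) }
      ; comm = λ f g → coeffs λ k → ≡⇒≈
          (trans (coeff-⊕ f g k) (trans (+-comm (coeff f k) (coeff g k)) (sym (coeff-⊕ g f k)))) } }
    where
    assoc : ∀ f g h k → coeff ((f ⊕ g) ⊕ h) k ≡ coeff (f ⊕ (g ⊕ h)) k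
    assoc f g h k rewrite coeff-⊕ (f ⊕ g) h k | coeff-⊕ f g k | coeff-⊕ f (g ⊕ h) k | coeff-⊕ g h k
      = +-assoc (coeff f k) (coeff g k) (coeff h k)

  open CommutativeMonoid ⊕-commutativeMonoid using () renaming
    ( setoid to ≋-setoid; identityʳ to ⊕-identityʳ; comm to ⊕-comm )
  open CommutativeSemigroupProperties (CommutativeMonoid.commutativeSemigroup ⊕-commutativeMonoid)
    using () renaming (interchange to ⊕-interchange; x∙yz≈y∙xz to ⊕-swap)
  import Relation.Binary.Reasoning.Setoid ≋-setoid as ≋-Reasoning

  ⊕-congˡ : ∀ f {g h} → g ≋ h → f ⊕ g ≋ f ⊕ h
  ⊕-congˡ f = ⊕-cong {f} ≋-refl

  ⊕-congʳ : ∀ f {g h} → g ≋ h → g ⊕ f ≋ h ⊕ f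
  ⊕-congʳ f u = ⊕-cong u (≋-refl {f})

  ∷-cong : ∀ {a b f g} → a ≈ b → f ≋ g → a ∷ f ≋ b ∷ g
  ∷-cong e (coeffs u) = coeffs λ { zero → e ; (suc k) → u k }

  0∷[]≋[] : ∀ {a f} → a ≈ 0 → f ≋ [] → a ∷ f ≋ []
  0∷[]≋[] e (coeffs u) = coeffs λ { zero → e ; (suc k) → u k }

  scale-cong : ∀ {a b f g} → a ≈ b → f ≋ g → scale a f ≋ scale b g
  scale-cong {a} {b} {f} {g} e (coeffs u) = coeffs λ k →
    ≈-trans (≡⇒≈ (coeff-scale a f k)) (≈-trans (*-cong≈ e (u k)) (≡⇒≈ (sym (coeff-scale b g k))))

  scale-⊕ : ∀ a f g → scale a (f ⊕ g) ≋ scale a f ⊕ scale a g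
  scale-⊕ a f g = coeffs λ k → ≡⇒≈ (lemma k)
    where
    lemma : ∀ k → coeff (scale a (f ⊕ g)) k ≡ coeff (scale a f ⊕ scale a g) k
    lemma k rewrite coeff-scale a (f ⊕ g) k | coeff-⊕ f g k | coeff-⊕ (scale a f) (scale a g) k
      | coeff-scale a f k | coeff-scale a g k = *-distribˡ-+ a (coeff f k) (coeff g k)

  scale-scale : ∀ a b f → scale a (scale b f) ≋ scale (a * b) f
  scale-scale a b f = coeffs λ k → ≡⇒≈ (lemma k)
    where
    lemma : ∀ k → coeff (scale a (scale b f)) k ≡ coeff (scale (a * b) f) k
    lemma k rewrite coeff-scale a (scale b f) k | coeff-scale b f k | coeff-scale (a * b) f k
      = sym (*-assoc a b (coeff f k))

  scale-0 : ∀ f → scale 0 f ≋ []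
  scale-0 f = coeffs λ k → ≡⇒≈ (coeff-scale 0 f k)

  scale-1 : ∀ f → scale 1 f ≋ f
  scale-1 f = coeffs λ k → ≡⇒≈ (trans (coeff-scale 1 f k) (*-identityˡ _))

  ⊗-zeroʳ : ∀ f → f ⊗ [] ≋ []
  ⊗-zeroʳ [] = ≋-refl
  ⊗-zeroʳ (a ∷ f) = 0∷[]≋[] ≈-refl (⊗-zeroʳ f)

  -- The recursion of `_⊗_` mirrored to its second argument, which is what an induction for
  -- commutativity needs.
  ⊗-∷ʳ : ∀ f b g → f ⊗ (b ∷ g) ≋ scale b f ⊕ (0 ∷ (f ⊗ g))
  ⊗-∷ʳ [] b g = ≋-sym (0∷[]≋[] ≈-refl ≋-refl)
  ⊗-∷ʳ (a ∷ f) b g = ∷-cong (≡⇒≈ (cong (_+ 0) (*-comm a b)))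
    (≋-trans (⊕-congˡ (scale a g) (⊗-∷ʳ f b g)) (⊕-swap (scale a g) (scale b f) (0 ∷ (f ⊗ g))))

  ⊗-comm : ∀ f g → f ⊗ g ≋ g ⊗ f
  ⊗-comm [] g = ≋-sym (⊗-zeroʳ g)
  ⊗-comm (a ∷ f) g = ≋-trans (⊕-congˡ (scale a g) (∷-cong ≈-refl (⊗-comm f g))) (≋-sym (⊗-∷ʳ g a f))

  ⊗-congˡ : ∀ f {g h} → g ≋ h → f ⊗ g ≋ f ⊗ h
  ⊗-congˡ [] u = ≋-refl
  ⊗-congˡ (a ∷ f) u = ⊕-cong (scale-cong {a} ≈-refl u) (∷-cong ≈-refl (⊗-congˡ f u))

  ⊗-cong : ∀ {f f′ g g′} → f ≋ f′ → g ≋ g′ → f ⊗ g ≋ f′ ⊗ g′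
  ⊗-cong {f} {f′} {g} {g′} u v =
    ≋-trans (⊗-comm f g) (≋-trans (⊗-congˡ g u) (≋-trans (⊗-comm g f′) (⊗-congˡ f′ v)))

  ⊗-distribˡ-⊕ : ∀ f g h → f ⊗ (g ⊕ h) ≋ (f ⊗ g) ⊕ (f ⊗ h)
  ⊗-distribˡ-⊕ [] g h = ≋-refl
  ⊗-distribˡ-⊕ (a ∷ f) g h =
    ≋-trans (⊕-cong (scale-⊕ a g h) (∷-cong ≈-refl (⊗-distribˡ-⊕ f g h)))
            (⊕-interchange (scale a g) (scale a h) (0 ∷ (f ⊗ g)) (0 ∷ (f ⊗ h)))

  ⊗-distribʳ-⊕ : ∀ h f g → (f ⊕ g) ⊗ h ≋ (f ⊗ h) ⊕ (g ⊗ h)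
  ⊗-distribʳ-⊕ h f g = ≋-trans (⊗-comm (f ⊕ g) h)
    (≋-trans (⊗-distribˡ-⊕ h f g) (⊕-cong (⊗-comm h f) (⊗-comm h g)))

  scale-⊗ : ∀ a f g → scale a f ⊗ g ≋ scale a (f ⊗ g)
  scale-⊗ a [] g = ≋-refl
  scale-⊗ a (b ∷ f) g = ≋-trans
    (⊕-cong (≋-sym (scale-scale a b g)) (∷-cong (≡⇒≈ (sym (*-zeroʳ a))) (scale-⊗ a f g)))
    (≋-sym (scale-⊕ a (scale b g) (0 ∷ (f ⊗ g))))

  0∷-⊗ : ∀ f g → (0 ∷ f) ⊗ g ≋ 0 ∷ (f ⊗ g)
  0∷-⊗ f g = ⊕-congʳ (0 ∷ (f ⊗ g)) (scale-0 g)

  ⊗-assoc : ∀ f g h → (f ⊗ g) ⊗ h ≋ f ⊗ (g ⊗ h)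
  ⊗-assoc [] g h = ≋-refl
  ⊗-assoc (a ∷ f) g h = ≋-trans (⊗-distribʳ-⊕ h (scale a g) (0 ∷ (f ⊗ g)))
    (⊕-cong (scale-⊗ a g h)
            (≋-trans (0∷-⊗ (f ⊗ g) h) (∷-cong ≈-refl (⊗-assoc f g h))))

  ⊗-identityˡ : ∀ f → (1 ∷ []) ⊗ f ≋ f
  ⊗-identityˡ f = ≋-trans (⊕-cong (scale-1 f) (0∷[]≋[] ≈-refl ≋-refl)) (⊕-identityʳ f)

  poly-semiring : CommutativeSemiring 0ℓ 0ℓ
  poly-semiring = record
    { Carrier = Poly ; _≈_ = _≋_ ; _+_ = _⊕_ ; _*_ = _⊗_ ; 0# = [] ; 1# = 1 ∷ []
    ; isCommutativeSemiring = record
      { isSemiring = record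
        { isSemiringWithoutAnnihilatingZero = record
          { +-isCommutativeMonoid = CommutativeMonoid.isCommutativeMonoid ⊕-commutativeMonoid
          ; *-cong = ⊗-cong
          ; *-assoc = ⊗-assoc
          ; *-identity = ⊗-identityˡ , λ f → ≋-trans (⊗-comm f (1 ∷ [])) (⊗-identityˡ f)
          ; distrib = ⊗-distribˡ-⊕ , ⊗-distribʳ-⊕ }
        ; zero = (λ f → ≋-refl) , ⊗-zeroʳ }
      ; *-comm = ⊗-comm } }

  ⊗-congʳ : ∀ f {g h} → g ≋ h → g ⊗ f ≋ h ⊗ f
  ⊗-congʳ f u = ⊗-cong u (≋-refl {f})

  open SemiringSolver poly-semiring using (solve; _:=_; _:+_; _:*_; con)

  C : ℕ → Poly
  C a = a ∷ []

  X : Poly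
  X = 0 ∷ 1 ∷ []

  scale≋C⊗ : ∀ a f → scale a f ≋ C a ⊗ f
  scale≋C⊗ a f = ≋-sym (≋-trans (⊕-congˡ (scale a f) (0∷[]≋[] ≈-refl ≋-refl)) (⊕-identityʳ _))

  X⊗ : ∀ f → 0 ∷ f ≋ X ⊗ f
  X⊗ f = ≋-sym (≋-trans (0∷-⊗ (1 ∷ []) f) (∷-cong ≈-refl (⊗-identityˡ f)))

  ∷≋ : ∀ a f → a ∷ f ≋ C a ⊕ (X ⊗ f)
  ∷≋ a f = ≋-trans (∷-cong (≡⇒≈ (sym (+-identityʳ a))) ≋-refl) (⊕-congˡ (C a) (X⊗ f))

  ⊕-cancelˡ : ∀ f {g h} → f ⊕ g ≋ f ⊕ h → g ≋ h
  ⊕-cancelˡ f {g} {h} (coeffs u) = coeffs λ k → +-cancelˡ≈ (coeff f k)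
    (≈-trans (≡⇒≈ (sym (coeff-⊕ f g k))) (≈-trans (u k) (≡⇒≈ (coeff-⊕ f h k))))

  ⊖_ : Poly → Poly
  ⊖ f = scale (p ∸ 1) f

  ⊕-inverseʳ : ∀ f → f ⊕ (⊖ f) ≋ []
  ⊕-inverseʳ f = coeffs λ k → ≈-trans
    (≡⇒≈ (trans (coeff-⊕ f (⊖ f) k) (cong (coeff f k +_) (coeff-scale (p ∸ 1) f k))))
    (+-inverseʳ (coeff f k))

  evalℕ-cong : ∀ {f g} x → f ≋ g → evalℕ f x ≈ evalℕ g x
  evalℕ-cong {[]} {[]} x u = ≈-refl
  evalℕ-cong {[]} {b ∷ g} x (coeffs u) =
    ≈-trans (≡⇒≈ (sym (*-zeroʳ x))) (+-cong≈ (u 0) (*-congˡ≈ x (evalℕ-cong {[]} {g} x (coeffs (u ∘ suc)))))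
  evalℕ-cong {a ∷ f} {[]} x (coeffs u) =
    ≈-trans (+-cong≈ (u 0) (*-congˡ≈ x (evalℕ-cong {f} {[]} x (coeffs (u ∘ suc))))) (≡⇒≈ (*-zeroʳ x))
  evalℕ-cong {a ∷ f} {b ∷ g} x (coeffs u) =
    +-cong≈ (u 0) (*-congˡ≈ x (evalℕ-cong {f} {g} x (coeffs (u ∘ suc))))

  der-cong : ∀ {f g} → f ≋ g → der f ≋ der g
  der-cong {f} {g} (coeffs u) = coeffs λ k → ≈-trans (≡⇒≈ (coeff-der f k))
    (≈-trans (*-congˡ≈ (suc k) (u (suc k))) (≡⇒≈ (sym (coeff-der g k))))

  der-⊕ : ∀ f g → der (f ⊕ g) ≋ der f ⊕ der g
  der-⊕ f g = coeffs λ k → ≡⇒≈ (lemma k)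
    where
    lemma : ∀ k → coeff (der (f ⊕ g)) k ≡ coeff (der f ⊕ der g) k
    lemma k rewrite coeff-der (f ⊕ g) k | coeff-⊕ f g (suc k) | coeff-⊕ (der f) (der g) k
      | coeff-der f k | coeff-der g k = *-distribˡ-+ (suc k) (coeff f (suc k)) (coeff g (suc k))

  der-scale : ∀ a f → der (scale a f) ≋ scale a (der f)
  der-scale a f = coeffs λ k → ≡⇒≈ (lemma k)
    where
    swap : ∀ x y z → x * (y * z) ≡ y * (x * z)
    swap = solve-∀
    lemma : ∀ k → coeff (der (scale a f)) k ≡ coeff (scale a (der f)) k
    lemma k rewrite coeff-der (scale a f) k | coeff-scale a f (suc k) | coeff-scale a (der f) k
      | coeff-der f k = swap (suc k) a (coeff f (suc k))

  der-⊗ : ∀ f g → der (f ⊗ g) ≋ (der f ⊗ g) ⊕ (f ⊗ der g)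
  der-⊗ [] g = ≋-refl
  der-⊗ (a ∷ f) g = begin
    der (scale a g ⊕ (0 ∷ (f ⊗ g)))
      ≈⟨ der-⊕ (scale a g) (0 ∷ (f ⊗ g)) ⟩
    der (scale a g) ⊕ ((f ⊗ g) ⊕ (0 ∷ der (f ⊗ g)))
      ≈⟨ ⊕-cong (≋-trans (der-scale a g) (scale≋C⊗ a (der g)))
           (⊕-congˡ (f ⊗ g) (≋-trans (∷-cong ≈-refl (der-⊗ f g)) (X⊗ _))) ⟩
    (C a ⊗ der g) ⊕ ((f ⊗ g) ⊕ (X ⊗ ((der f ⊗ g) ⊕ (f ⊗ der g))))
      ≈⟨ solve 6 (λ c x f g f′ g′ → c :* g′ :+ (f :* g :+ x :* (f′ :* g :+ f :* g′))
            := (f :+ x :* f′) :* g :+ (c :+ x :* f) :* g′) ≋-refl (C a) X f g (der f) (der g) ⟩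
    ((f ⊕ (X ⊗ der f)) ⊗ g) ⊕ ((C a ⊕ (X ⊗ f)) ⊗ der g)
      ≈⟨ ⊕-cong (⊗-congʳ g (⊕-congˡ f (X⊗ (der f)))) (⊗-congʳ (der g) (∷≋ a f)) ⟨
    (der (a ∷ f) ⊗ g) ⊕ ((a ∷ f) ⊗ der g) ∎
    where open ≋-Reasoning

  -- Degree bounds and cancellation

  -- A bound instead of a degree: no leading coefficient has to be located, and the zero polynomial
  -- is the case n = 0.
  _deg<_ : Poly → ℕ → Set
  f deg< n = ∀ k → n ≤ k → coeff f k ≈ 0

  deg<-cong : ∀ {f g n} → f ≋ g → f deg< n → g deg< n
  deg<-cong (coeffs u) d k n≤k = ≈-trans (≈-sym (u k)) (d k n≤k)

  deg<-mono : ∀ {f m n} → m ≤ n → f deg< m → f deg< n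
  deg<-mono m≤n d k n≤k = d k (≤-trans m≤n n≤k)

  deg<-⊕ : ∀ {n} f g → f deg< n → g deg< n → (f ⊕ g) deg< n
  deg<-⊕ f g d e k n≤k = ≈-trans (≡⇒≈ (coeff-⊕ f g k)) (+-cong≈ (d k n≤k) (e k n≤k))

  deg<-scale : ∀ {n} a f → f deg< n → scale a f deg< n
  deg<-scale a f d k n≤k = ≈-trans (≡⇒≈ (coeff-scale a f k))
    (≈-trans (*-congˡ≈ a (d k n≤k)) (≡⇒≈ (*-zeroʳ a)))

  deg<-length : ∀ f → f deg< length f
  deg<-length [] k _ = ≈-refl
  deg<-length (a ∷ f) (suc k) (s≤s le) = deg<-length f k le

  deg<0⇒≋[] : ∀ {f} → f deg< 0 → f ≋ []
  deg<0⇒≋[] d = coeffs λ k → d k z≤n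

  deg<-tail : ∀ {a f n} → (a ∷ f) deg< n → f deg< pred n
  deg<-tail {n = zero} d k le = d (suc k) z≤n
  deg<-tail {n = suc n} d k le = d (suc k) (s≤s le)

  deg<1⇒≋C : ∀ {f} → f deg< 1 → f ≋ C (coeff f 0)
  deg<1⇒≋C d = coeffs λ { zero → ≈-refl ; (suc k) → d (suc k) (s≤s z≤n) }

  der-deg< : ∀ {n} f → f deg< suc n → der f deg< n
  der-deg< f d k n≤k = ≈-trans (≡⇒≈ (coeff-der f k))
    (≈-trans (*-congˡ≈ (suc k) (d (suc k) (s≤s n≤k))) (≡⇒≈ (*-zeroʳ k)))

  -- For m = 0 the tail of f vanishes and only a·g is left. For m > 0 the term a·g stays below index
  -- m + n, so both the bound and the top coefficient are inherited from the shifted product with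
  -- the tail.
  ⊗-top : ∀ {m n} f g → f deg< suc m → g deg< suc n →
    (f ⊗ g) deg< suc (m + n) × coeff (f ⊗ g) (m + n) ≈ coeff f m * coeff g n
  ⊗-top [] g d e = (λ k _ → ≈-refl) , ≈-refl
  ⊗-top {m} {n} (a ∷ f) g d e = go m (deg<-tail {a} d)
    where
    expand : ∀ k → coeff ((a ∷ f) ⊗ g) k ≈ a * coeff g k + coeff (0 ∷ (f ⊗ g)) k
    expand k = ≡⇒≈ (trans (coeff-⊕ (scale a g) (0 ∷ (f ⊗ g)) k)
      (cong (_+ coeff (0 ∷ (f ⊗ g)) k) (coeff-scale a g k)))
    high : ∀ k → n < k → a * coeff g k ≈ 0
    high k n<k = ≈-trans (*-congˡ≈ a (e k n<k)) (≡⇒≈ (*-zeroʳ a))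
    go : ∀ m → f deg< m → ((a ∷ f) ⊗ g) deg< suc (m + n) ×
      coeff ((a ∷ f) ⊗ g) (m + n) ≈ coeff (a ∷ f) m * coeff g n
    go zero d′ = (λ k n<k → ≈-trans (expand k) (+-cong≈ (high k n<k) (coeff≈ shifted≋[] k))) ,
      ≈-trans (expand n) (≈-trans (+-congˡ≈ (a * coeff g n) (coeff≈ shifted≋[] n)) (≡⇒≈ (+-identityʳ _)))
      where
      shifted≋[] : 0 ∷ (f ⊗ g) ≋ []
      shifted≋[] = 0∷[]≋[] ≈-refl (⊗-congʳ g (deg<0⇒≋[] {f} d′))
    go (suc m) d′ with ⊗-top f g d′ e
    ... | low , top =
      (λ { (suc k) (s≤s le) → ≈-trans (expand (suc k))
             (+-cong≈ (high (suc k) (s≤s (≤-trans (m≤n+m n (suc m)) le))) (low k le)) }) ,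
      ≈-trans (expand (suc m + n)) (+-cong≈ (high (suc m + n) (s≤s (m≤n+m n m))) top)

  -- The bound `length g` is lowered step by step: for N ≥ n the coefficient of g·d at N + b is
  -- zero, and it is the coefficient of g at N times a nonzero leading coefficient.
  deg<-cancelʳ : ∀ {n b} g d → d deg< suc b → coeff d b ≉ 0 → (g ⊗ d) deg< (n + b) → g deg< n
  deg<-cancelʳ {n} {b} g d d< lead≉0 gd< = descend (length g) (deg<-length g)
    where
    descend : ∀ N → g deg< N → g deg< n
    descend zero g< = deg<-mono {g} z≤n g<
    descend (suc N) g< with n ≤? N
    ... | no n≰N = deg<-mono {g} (≰⇒> n≰N) g<
    ... | yes n≤N = descend N λ k N≤k → lower k (m≤n⇒m<n∨m≡n N≤k)
      where
      topN : coeff d b * coeff g N ≈ 0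
      topN = ≈-trans (≡⇒≈ (*-comm (coeff d b) (coeff g N)))
        (≈-trans (≈-sym (proj₂ (⊗-top g d g< d<))) (gd< (N + b) (+-monoˡ-≤ b n≤N)))
      lower : ∀ k → N < k ⊎ N ≡ k → coeff g k ≈ 0
      lower k (inj₁ N<k) = g< k N<k
      lower k (inj₂ refl) = integral≉ lead≉0 topN

  -- Roots

  X-_ : ℕ → Poly
  X- x = (- x) ∷ 1 ∷ []

  evalℕ-X- : ∀ x y → evalℕ (X- x) y ≡ - x + y
  evalℕ-X- x y = cong (- x +_) (lemma y)
    where
    lemma : ∀ y → y * (1 + y * 0) ≡ y
    lemma = solve-∀

  evalℕ-X-≈0 : ∀ x → evalℕ (X- x) x ≈ 0
  evalℕ-X-≈0 x = ≈-trans (≡⇒≈ (trans (evalℕ-X- x x) (+-comm (- x) x))) (+-inverseʳ x)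

  evalℕ-X-≉0 : ∀ {x y} → x ≉ y → evalℕ (X- x) y ≉ 0
  evalℕ-X-≉0 {x} {y} x≉y e = x≉y (≈-sym (+-cancelˡ≈ (- x)
    (≈-trans (≡⇒≈ (sym (evalℕ-X- x y))) (≈-trans e (≈-trans (≈-sym (evalℕ-X-≈0 x)) (≡⇒≈ (evalℕ-X- x x)))))))

  ⊗-quot : ∀ f x → f ≋ C (evalℕ f x) ⊕ ((X- x) ⊗ quot f x)
  ⊗-quot [] x = ≋-sym (⊕-cong (0∷[]≋[] ≈-refl ≋-refl) (⊗-zeroʳ (X- x)))
  ⊗-quot (a ∷ f) x = begin
    a ∷ f                          ≈⟨ ∷≋ a f ⟩
    C a ⊕ (X ⊗ f)                  ≈⟨ ⊕-congˡ (C a) (⊗-congˡ X (⊗-quot f x)) ⟩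
    C a ⊕ (X ⊗ (C e ⊕ (L ⊗ q)))    ≈⟨ solve 5 (λ a X e L q → a :+ X :* (e :+ L :* q)
                                        := a :+ (X :* e :+ L :* (X :* q))) ≋-refl (C a) X (C e) L q ⟩
    C a ⊕ ((X ⊗ C e) ⊕ (L ⊗ (X ⊗ q)))
      -- Only the X in front of the constant e is split as x + (X - x): x·e joins a to give the new
      -- value, and (X - x)·e supplies the first entry of the quotient.
      ≈⟨ ⊕-congˡ (C a) (⊕-congʳ (L ⊗ (X ⊗ q)) (⊗-congʳ (C e) split)) ⟩
    C a ⊕ (((C x ⊕ L) ⊗ C e) ⊕ (L ⊗ (X ⊗ q)))
      ≈⟨ solve 5 (λ a x e L r → a :+ ((x :+ L) :* e :+ L :* r)
           := (a :+ x :* e) :+ L :* (e :+ r)) ≋-refl (C a) (C x) (C e) L (X ⊗ q) ⟩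
    (C a ⊕ (C x ⊗ C e)) ⊕ (L ⊗ (C e ⊕ (X ⊗ q)))
      ≈⟨ ⊕-cong (∷-cong (≡⇒≈ (cong (a +_) (+-identityʳ (x * e)))) ≋-refl) (⊗-congˡ L (≋-sym (∷≋ e q))) ⟩
    C (a + x * e) ⊕ (L ⊗ (e ∷ q)) ∎
    where
    open ≋-Reasoning
    e = evalℕ f x
    q = quot f x
    L = X- x
    split : X ≋ C x ⊕ L
    split = ∷-cong (≈-sym (+-inverseʳ x)) ≋-refl

  quot-deg< : ∀ {n} f x → f deg< n → quot f x deg< pred n
  quot-deg< [] x d k le = ≈-refl
  quot-deg< {zero} (a ∷ f) x d zero le = evalℕ-cong {f} x (deg<0⇒≋[] (deg<-tail {a} d))
  quot-deg< {suc zero} (a ∷ f) x d zero le = evalℕ-cong {f} x (deg<0⇒≋[] (deg<-tail {a} d))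
  quot-deg< {n} (a ∷ f) x d (suc k) le = quot-deg< f x (deg<-tail {a} d) k (pred-mono-≤ le)

  root⇒factor : ∀ f x → evalℕ f x ≈ 0 → f ≋ (X- x) ⊗ quot f x
  root⇒factor f x e = ≋-trans (⊗-quot f x) (⊕-congʳ ((X- x) ⊗ quot f x) (0∷[]≋[] e ≋-refl))

  root-quot : ∀ {f x y} → x ≉ y → evalℕ f x ≈ 0 → evalℕ f y ≈ 0 → evalℕ (quot f x) y ≈ 0
  root-quot {f} {x} {y} x≉y fx fy = integral≉ (evalℕ-X-≉0 x≉y)
    (≈-trans (≡⇒≈ (sym (evalℕ-⊗ (X- x) (quot f x) y)))
      (≈-trans (≈-sym (evalℕ-cong y (root⇒factor f x fx))) fy))

  Distinct : List ℕ → Set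
  Distinct = AllPairs _≉_

  manyRoots⇒≋[] : ∀ f xs → Distinct xs → All (λ x → evalℕ f x ≈ 0) xs → f deg< length xs → f ≋ []
  manyRoots⇒≋[] f [] _ _ d = deg<0⇒≋[] d
  manyRoots⇒≋[] f (x ∷ xs) (x≉xs ∷ distinct) (fx ∷ fxs) d =
    ≋-trans (root⇒factor f x fx) (≋-trans (⊗-congˡ (X- x) q≋[]) (⊗-zeroʳ (X- x)))
    where
    q≋[] : quot f x ≋ []
    q≋[] = manyRoots⇒≋[] (quot f x) xs distinct
      (All.zipWith (λ { (x≉y , fy) → root-quot {f} x≉y fx fy }) (x≉xs , fxs)) (quot-deg< f x d)

  upTo-distinct : Distinct (upTo p)
  upTo-distinct = AllPairs.applyUpTo⁺₁ _ p λ i<j j<p e → <⇒≢ i<j (<p⇒≡ (<-trans i<j j<p) j<p e)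

  -- The polynomial X^p - X

  mono : ℕ → Poly
  mono zero = 1 ∷ []
  mono (suc n) = 0 ∷ mono n

  coeff-mono : ∀ n → coeff (mono n) n ≡ 1
  coeff-mono zero = refl
  coeff-mono (suc n) = coeff-mono n

  coeff-mono-≢ : ∀ n k → n ≢ k → coeff (mono n) k ≡ 0
  coeff-mono-≢ zero zero n≢k = contradiction refl n≢k
  coeff-mono-≢ zero (suc k) n≢k = refl
  coeff-mono-≢ (suc n) zero n≢k = refl
  coeff-mono-≢ (suc n) (suc k) n≢k = coeff-mono-≢ n k (n≢k ∘ cong suc)

  evalℕ-mono : ∀ n x → evalℕ (mono n) x ≡ x ^ n
  evalℕ-mono zero x = cong suc (*-zeroʳ x)
  evalℕ-mono (suc n) x = cong (x *_) (evalℕ-mono n x)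

  pow-cong : ∀ {f g} n → f ≋ g → pow f n ≋ pow g n
  pow-cong zero u = ≋-refl
  pow-cong (suc n) u = ⊗-cong u (pow-cong n u)

  -- Multiplied by f, so that no exponent n - 1 occurs.
  der-pow : ∀ f n → f ⊗ der (pow f n) ≋ C n ⊗ (pow f n ⊗ der f)
  der-pow f zero = ≋-trans (⊗-congˡ f (0∷[]≋[] {f = []} ≈-refl ≋-refl))
    (≋-trans (⊗-zeroʳ f) (≋-sym (⊗-congʳ ((1 ∷ []) ⊗ der f) (0∷[]≋[] {f = []} ≈-refl ≋-refl))))
  der-pow f (suc n) = begin
    f ⊗ der (f ⊗ pow f n)
      ≈⟨ ⊗-congˡ f (der-⊗ f (pow f n)) ⟩
    f ⊗ ((der f ⊗ pow f n) ⊕ (f ⊗ der (pow f n)))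
      ≈⟨ ⊗-congˡ f (⊕-congˡ (der f ⊗ pow f n) (der-pow f n)) ⟩
    f ⊗ ((der f ⊗ pow f n) ⊕ (C n ⊗ (pow f n ⊗ der f)))
      ≈⟨ solve 4 (λ f f′ g c → f :* (f′ :* g :+ c :* (g :* f′))
           := (con 1 :+ c) :* ((f :* g) :* f′)) ≋-refl f (der f) (pow f n) (C n) ⟩
    C (suc n) ⊗ (pow f (suc n) ⊗ der f) ∎
    where open ≋-Reasoning

  pow-monic : ∀ a n → pow (a ∷ 1 ∷ []) n deg< suc n × coeff (pow (a ∷ 1 ∷ []) n) n ≈ 1
  pow-monic a zero = (λ { (suc k) le → ≈-refl }) , ≈-refl
  pow-monic a (suc n) with pow-monic a n
  ... | d , t with ⊗-top {1} (a ∷ 1 ∷ []) (pow (a ∷ 1 ∷ []) n) linear d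
    where
    linear : (a ∷ 1 ∷ []) deg< 2
    linear (suc zero) (s≤s ())
    linear (suc (suc k)) le = ≈-refl
  ... | d′ , t′ = d′ , ≈-trans t′ (≈-trans (≡⇒≈ (*-identityˡ _)) t)

  -- The derivative of (X + 1)^p is zero, so only its extreme coefficients survive.
  frobenius : pow (1 ∷ 1 ∷ []) p ≋ (1 ∷ []) ⊕ mono p
  frobenius = coeffs λ k → ≈-trans (agree k) (≡⇒≈ (sym (coeff-⊕ (1 ∷ []) (mono p) k)))
    where
    g = pow (1 ∷ 1 ∷ []) p
    der≋[] : der g ≋ []
    -- By `der-pow` with n = p, the product (1 + X)g' is a multiple of p, and the factor 1 + X
    -- cancels.
    der≋[] = deg<0⇒≋[] (deg<-cancelʳ {0} {1} (der g) (1 ∷ 1 ∷ [])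
      (λ { (suc zero) (s≤s ()) ; (suc (suc k)) _ → ≈-refl }) 1≉0
      (deg<-cong {[]} (≋-sym (≋-trans (⊗-comm (der g) (1 ∷ 1 ∷ [])) (≋-trans (der-pow (1 ∷ 1 ∷ []) p)
        (⊗-congʳ (g ⊗ der (1 ∷ 1 ∷ [])) (0∷[]≋[] p≈0 ≋-refl))))) λ _ _ → ≈-refl))
    agree : ∀ k → coeff g k ≈ coeff (1 ∷ []) k + coeff (mono p) k
    agree zero = ≈-trans (≡⇒≈ (trans (constant g) (trans (evalℕ-pow (1 ∷ 1 ∷ []) p 0) (^-zeroˡ p))))
      (≡⇒≈ (sym (cong suc (coeff-mono-≢ p 0 (≢-sym (<⇒≢ (<-trans z<s 2≤p)))))))
      where
      constant : ∀ f → coeff f 0 ≡ evalℕ f 0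
      constant [] = refl
      constant (a ∷ f) = sym (+-identityʳ a)
    agree (suc k) with <-cmp (suc k) p
    ... | tri< k<p k≢p _ = ≈-trans
      (integral≉ (0<·<p⇒≉0 z<s k<p) (≈-trans (≡⇒≈ (sym (coeff-der g k))) (coeff≈ der≋[] k)))
      (≡⇒≈ (sym (coeff-mono-≢ p (suc k) (≢-sym k≢p))))
    ... | tri≈ _ refl _ = ≈-trans (proj₂ (pow-monic 1 p)) (≡⇒≈ (sym (coeff-mono p)))
    ... | tri> _ k≢p p<k = ≈-trans (proj₁ (pow-monic 1 p) (suc k) p<k)
      (≡⇒≈ (sym (coeff-mono-≢ p (suc k) (≢-sym k≢p))))

  -- Induction on x: `frobenius` evaluated at x gives (x + 1)^p = 1 + x^p.
  fermat : ∀ x → x ^ p ≈ x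
  fermat zero = ≡⇒≈ (subst (λ n → 0 ^ n ≡ 0) suc[p∸1]≡p refl)
  fermat (suc x) = begin
    suc x ^ p                          ≡⟨ cong (_^ p) (lemma x) ⟨
    evalℕ (1 ∷ 1 ∷ []) x ^ p           ≡⟨ evalℕ-pow (1 ∷ 1 ∷ []) p x ⟨
    evalℕ (pow (1 ∷ 1 ∷ []) p) x       ≈⟨ evalℕ-cong x frobenius ⟩
    evalℕ ((1 ∷ []) ⊕ mono p) x        ≡⟨ evalℕ-⊕ (1 ∷ []) (mono p) x ⟩
    evalℕ (1 ∷ []) x + evalℕ (mono p) x
      ≡⟨ cong₂ _+_ (cong suc (*-zeroʳ x)) (evalℕ-mono p x) ⟩
    1 + x ^ p                          ≈⟨ +-congˡ≈ 1 (fermat x) ⟩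
    1 + x                              ∎
    where
    open ≈-Reasoning
    lemma : ∀ x → 1 + x * (1 + x * 0) ≡ suc x
    lemma = solve-∀

  D : Poly
  D = mono p ⊕ (⊖ X)

  coeff-D : ∀ k → 2 ≤ k → coeff D k ≡ coeff (mono p) k
  coeff-D (suc (suc k)) _ = trans (coeff-⊕ (mono p) (⊖ X) (2 + k)) (+-identityʳ _)
  coeff-D (suc zero) (s≤s ())

  D-monic : coeff D p ≡ 1
  D-monic = trans (coeff-D p 2≤p) (coeff-mono p)

  D-deg< : D deg< suc p
  D-deg< k p<k = ≡⇒≈ (trans (coeff-D k (≤-trans 2≤p (<⇒≤ p<k))) (coeff-mono-≢ p k (<⇒≢ p<k)))

  evalℕ-D : ∀ x → evalℕ D x ≈ 0
  evalℕ-D x = begin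
    evalℕ D x                            ≡⟨ evalℕ-⊕ (mono p) (⊖ X) x ⟩
    evalℕ (mono p) x + evalℕ (⊖ X) x     ≡⟨ cong₂ _+_ (evalℕ-mono p x) (evalℕ-scale (p ∸ 1) X x) ⟩
    x ^ p + - evalℕ X x                  ≡⟨ cong (λ y → x ^ p + - y) (lemma x) ⟩
    x ^ p + - x                          ≈⟨ +-congʳ≈ (- x) (fermat x) ⟩
    x + - x                              ≈⟨ +-inverseʳ x ⟩
    0                                    ∎
    where
    open ≈-Reasoning
    lemma : ∀ x → x * (1 + x * 0) ≡ x
    lemma = solve-∀

  der-mono-p : der (mono p) ≋ []
  der-mono-p = coeffs λ k → ≈-trans (≡⇒≈ (coeff-der (mono p) k)) (vanish k)
    where
    vanish : ∀ k → suc k * coeff (mono p) (suc k) ≈ 0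
    vanish k with p ≟ suc k
    ... | yes e = *-cong≈ (subst (_≈ 0) e p≈0) (≈-refl {coeff (mono p) (suc k)})
    ... | no ¬e = ≡⇒≈ (trans (cong (suc k *_) (coeff-mono-≢ p (suc k) ¬e)) (*-zeroʳ k))

  der-D : der D ⊕ C 1 ≋ []
  der-D = begin
    der D ⊕ C 1
      ≈⟨ ⊕-congʳ (C 1) (≋-trans (der-⊕ (mono p) (⊖ X)) (⊕-cong der-mono-p (der-scale (p ∸ 1) X))) ⟩
    (⊖ der X) ⊕ C 1        ≈⟨ ⊕-congʳ (C 1) (scale-cong {p ∸ 1} ≈-refl der-X) ⟩
    (⊖ C 1) ⊕ C 1          ≈⟨ ⊕-comm (⊖ C 1) (C 1) ⟩
    C 1 ⊕ (⊖ C 1)          ≈⟨ ⊕-inverseʳ (C 1) ⟩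
    []                     ∎
    where
    open ≋-Reasoning
    der-X : der X ≋ C 1
    der-X = coeffs λ { zero → ≈-refl ; (suc zero) → ≈-refl ; (suc (suc k)) → ≈-refl }

  D/[X-_] : ℕ → Poly
  D/[X- x ] = quot D x

  D-factor : ∀ x → D ≋ (X- x) ⊗ D/[X- x ]
  D-factor x = root⇒factor D x (evalℕ-D x)

  evalℕ-der-⊗-root : ∀ {f g h x} → f ≋ g ⊗ h → evalℕ g x ≈ 0 →
    evalℕ (der f) x ≈ evalℕ (der g) x * evalℕ h x
  evalℕ-der-⊗-root {f} {g} {h} {x} u gx = begin
    evalℕ (der f) x                              ≈⟨ evalℕ-cong x (≋-trans (der-cong u) (der-⊗ g h)) ⟩
    evalℕ ((der g ⊗ h) ⊕ (g ⊗ der h)) x          ≡⟨ evalℕ-⊕ (der g ⊗ h) (g ⊗ der h) x ⟩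
    evalℕ (der g ⊗ h) x + evalℕ (g ⊗ der h) x
      ≡⟨ cong₂ _+_ (evalℕ-⊗ (der g) h x) (evalℕ-⊗ g (der h) x) ⟩
    evalℕ (der g) x * evalℕ h x + evalℕ g x * evalℕ (der h) x
      ≈⟨ +-congˡ≈ (evalℕ (der g) x * evalℕ h x) (*-congʳ≈ (evalℕ (der h) x) gx) ⟩
    evalℕ (der g) x * evalℕ h x + 0              ≡⟨ +-identityʳ _ ⟩
    evalℕ (der g) x * evalℕ h x                  ∎
    where open ≈-Reasoning

  der-X- : ∀ x → der (X- x) ≋ C 1
  der-X- x = coeffs λ { zero → ≈-refl ; (suc zero) → ≈-refl ; (suc (suc k)) → ≈-refl }

  evalℕ-der-X- : ∀ x y → evalℕ (der (X- x)) y ≡ 1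
  evalℕ-der-X- x y = cong suc (lemma y)
    where
    lemma : ∀ y → y * (0 + y * 0) ≡ 0
    lemma = solve-∀

  -- D/(X - x) takes at x the value D'(x) = -1. Together with the vanishing at all other points,
  -- this makes the polynomials -D/(X - x) the Lagrange basis.
  evalℕ-D/-same : ∀ x → evalℕ D/[X- x ] x + 1 ≈ 0
  evalℕ-D/-same x = begin
    evalℕ D/[X- x ] x + 1
      ≡⟨ cong (_+ 1) (trans (sym (*-identityˡ _)) (cong (_* evalℕ D/[X- x ] x) (sym (evalℕ-der-X- x x)))) ⟩
    evalℕ (der (X- x)) x * evalℕ D/[X- x ] x + 1
      ≈⟨ +-congʳ≈ 1 (evalℕ-der-⊗-root {D} {X- x} {D/[X- x ]} {x} (D-factor x) (evalℕ-X-≈0 x)) ⟨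
    evalℕ (der D) x + 1
      ≡⟨ cong (λ y → evalℕ (der D) x + suc y) (*-zeroʳ x) ⟨
    evalℕ (der D) x + evalℕ (C 1) x         ≡⟨ evalℕ-⊕ (der D) (C 1) x ⟨
    evalℕ (der D ⊕ C 1) x                   ≈⟨ evalℕ-cong x der-D ⟩
    0                                       ∎
    where open ≈-Reasoning

  evalℕ-D/-other : ∀ {x y} → x ≉ y → evalℕ D/[X- x ] y ≈ 0
  evalℕ-D/-other {x} {y} x≉y = root-quot {D} x≉y (evalℕ-D x) (evalℕ-D y)

  -- Fully reducible polynomials and their logarithmic derivatives

  fromRoots : List ℕ → Poly
  fromRoots [] = 1 ∷ []
  fromRoots (x ∷ xs) = (X- x) ⊗ fromRoots xs

  fromRoots-monic : ∀ xs → fromRoots xs deg< suc (length xs) × coeff (fromRoots xs) (length xs) ≈ 1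
  fromRoots-monic [] = (λ { (suc k) le → ≈-refl }) , ≈-refl
  fromRoots-monic (x ∷ xs) with fromRoots-monic xs
  ... | d , t with ⊗-top {1} (X- x) (fromRoots xs) linear d
    where
    linear : (X- x) deg< 2
    linear (suc zero) (s≤s ())
    linear (suc (suc k)) le = ≈-refl
  ... | d′ , t′ = d′ , ≈-trans t′ (≈-trans (≡⇒≈ (*-identityˡ _)) t)

  -- D times the logarithmic derivative of `fromRoots xs`; a polynomial, because every x is a root
  -- of D.
  ΣD/ : List ℕ → Poly
  ΣD/ [] = []
  ΣD/ (x ∷ xs) = D/[X- x ] ⊕ ΣD/ xs

  ΣD/-deg< : ∀ xs → ΣD/ xs deg< p
  ΣD/-deg< [] k _ = ≈-refl
  ΣD/-deg< (x ∷ xs) = deg<-⊕ D/[X- x ] (ΣD/ xs) (quot-deg< D x D-deg<) (ΣD/-deg< xs)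

  -- Additivity of the logarithmic derivative over the linear factors, with both denominators
  -- cleared.
  log-der : ∀ xs → der (fromRoots xs) ⊗ D ≋ fromRoots xs ⊗ ΣD/ xs
  log-der [] = ≋-trans (⊗-congʳ D (0∷[]≋[] {f = []} ≈-refl ≋-refl)) (≋-sym (⊗-zeroʳ (1 ∷ [])))
  log-der (x ∷ xs) = begin
    der (L ⊗ F) ⊗ D
      ≈⟨ ⊗-congʳ D (≋-trans (der-⊗ L F) (⊕-congʳ (L ⊗ der F) (⊗-congʳ F (der-X- x)))) ⟩
    ((C 1 ⊗ F) ⊕ (L ⊗ der F)) ⊗ D
      ≈⟨ solve 4 (λ L F F′ D → (con 1 :* F :+ L :* F′) :* D := F :* D :+ L :* (F′ :* D))
           ≋-refl L F (der F) D ⟩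
    (F ⊗ D) ⊕ (L ⊗ (der F ⊗ D))
      ≈⟨ ⊕-cong (⊗-congˡ F (D-factor x)) (⊗-congˡ L (log-der xs)) ⟩
    (F ⊗ (L ⊗ D/[X- x ])) ⊕ (L ⊗ (F ⊗ ΣD/ xs))
      ≈⟨ solve 4 (λ L F d s → F :* (L :* d) :+ L :* (F :* s) := (L :* F) :* (d :+ s))
           ≋-refl L F D/[X- x ] (ΣD/ xs) ⟩
    (L ⊗ F) ⊗ (D/[X- x ] ⊕ ΣD/ xs) ∎
    where
    open ≋-Reasoning
    L = X- x
    F = fromRoots xs

  withMultiplicity : (ℕ → ℕ) → List ℕ → List ℕ
  withMultiplicity v = concatMap (λ x → replicate (v x) x)

  -- Here the range sum, a sum of integers and not of residues, becomes the degree of F.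
  length-withMultiplicity : ∀ v xs → length (withMultiplicity v xs) ≡ sum (map v xs)
  length-withMultiplicity v [] = refl
  length-withMultiplicity v (x ∷ xs) = trans (length-++ (replicate (v x) x))
    (cong₂ _+_ (length-replicate (v x)) (length-withMultiplicity v xs))

  evalℕ-ΣD/-replicate : ∀ n x ys y →
    evalℕ (ΣD/ (replicate n x ++ ys)) y ≡ n * evalℕ D/[X- x ] y + evalℕ (ΣD/ ys) y
  evalℕ-ΣD/-replicate zero x ys y = refl
  evalℕ-ΣD/-replicate (suc n) x ys y =
    trans (evalℕ-⊕ D/[X- x ] (ΣD/ (replicate n x ++ ys)) y)
      (trans (cong (evalℕ D/[X- x ] y +_) (evalℕ-ΣD/-replicate n x ys y))
        (sym (+-assoc (evalℕ D/[X- x ] y) (n * evalℕ D/[X- x ] y) _)))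

  evalℕ-ΣD/-∉ : ∀ v xs y → All (_≉ y) xs → evalℕ (ΣD/ (withMultiplicity v xs)) y ≈ 0
  evalℕ-ΣD/-∉ v [] y [] = ≈-refl
  evalℕ-ΣD/-∉ v (x ∷ xs) y (x≉y ∷ xs≉y) = ≈-trans
    (≡⇒≈ (evalℕ-ΣD/-replicate (v x) x (withMultiplicity v xs) y))
    (+-cong≈ (≈-trans (*-congˡ≈ (v x) (evalℕ-D/-other x≉y)) (≡⇒≈ (*-zeroʳ (v x))))
      (evalℕ-ΣD/-∉ v xs y xs≉y))

  -- Only the `v y` copies of y contribute at y, each of them -1.
  evalℕ-ΣD/-∈ : ∀ v xs {y} → Distinct xs → y ∈ xs →
    evalℕ (ΣD/ (withMultiplicity v xs)) y + v y ≈ 0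
  evalℕ-ΣD/-∈ v (y ∷ xs) (y≉xs ∷ _) (here refl) = begin
    evalℕ (ΣD/ (withMultiplicity v (y ∷ xs))) y + v y
      ≡⟨ cong (_+ v y) (evalℕ-ΣD/-replicate (v y) y (withMultiplicity v xs) y) ⟩
    v y * evalℕ D/[X- y ] y + evalℕ (ΣD/ (withMultiplicity v xs)) y + v y
      ≈⟨ +-congʳ≈ (v y) (+-congˡ≈ (v y * evalℕ D/[X- y ] y)
           (evalℕ-ΣD/-∉ v xs y (All.map (_∘ ≈-sym) y≉xs))) ⟩
    v y * evalℕ D/[X- y ] y + 0 + v y
      ≡⟨ lemma (v y) (evalℕ D/[X- y ] y) ⟩
    v y * (evalℕ D/[X- y ] y + 1)
      ≈⟨ *-congˡ≈ (v y) (evalℕ-D/-same y) ⟩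
    v y * 0 ≡⟨ *-zeroʳ (v y) ⟩
    0 ∎
    where
    open ≈-Reasoning
    lemma : ∀ v d → v * d + 0 + v ≡ v * (d + 1)
    lemma = solve-∀
  evalℕ-ΣD/-∈ v (x ∷ xs) {y} (x≉xs ∷ distinct) (there y∈xs) = begin
    evalℕ (ΣD/ (withMultiplicity v (x ∷ xs))) y + v y
      ≡⟨ cong (_+ v y) (evalℕ-ΣD/-replicate (v x) x (withMultiplicity v xs) y) ⟩
    v x * evalℕ D/[X- x ] y + evalℕ (ΣD/ (withMultiplicity v xs)) y + v y
      ≡⟨ +-assoc (v x * evalℕ D/[X- x ] y) _ (v y) ⟩
    v x * evalℕ D/[X- x ] y + (evalℕ (ΣD/ (withMultiplicity v xs)) y + v y)
      ≈⟨ +-cong≈ (*-congˡ≈ (v x) (evalℕ-D/-other (All.lookup x≉xs y∈xs))) (evalℕ-ΣD/-∈ v xs distinct y∈xs) ⟩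
    v x * 0 + 0 ≡⟨ cong (_+ 0) (*-zeroʳ (v x)) ⟩
    0 ∎
    where open ≈-Reasoning

  -- The differential equation f′h = (f - 1)(f - s)

  value : Poly → ℕ → ℕ
  value f x = evalℕ f x % p

  -- Lagrange interpolation: f is the sum of -f(x) D/(X - x) over all x.
  lagrange : ∀ f → f deg< p → ΣD/ (withMultiplicity (value f) (upTo p)) ⊕ f ≋ []
  lagrange f d = manyRoots⇒≋[] (S ⊕ f) (upTo p) upTo-distinct (All.tabulate root)
    (subst ((S ⊕ f) deg<_) (sym (length-upTo p)) (deg<-⊕ S f (ΣD/-deg< xs) d))
    where
    xs = withMultiplicity (value f) (upTo p)
    S = ΣD/ xs
    root : ∀ {y} → y ∈ upTo p → evalℕ (S ⊕ f) y ≈ 0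
    root {y} y∈ = ≈-trans (≡⇒≈ (evalℕ-⊕ S f y)) (≈-trans
      (+-congˡ≈ (evalℕ S y) (≈-sym (%-≈ (evalℕ f y))))
      (evalℕ-ΣD/-∈ (value f) (upTo p) upTo-distinct y∈))

  -- All that is kept of F: s is the constant F' + f, and h is F - D. Negative terms are moved
  -- across in every field; `der-h` is F' + f = s rewritten with F' = h' - 1.
  record ODE (f : Poly) (m : ℕ) : Set where
    field
      s        : ℕ
      h        : Poly
      product  : (C s ⊗ D) ⊕ (f ⊗ h) ≋ []
      der-h    : der h ⊕ f ≋ C (suc s)
      equation : (der f ⊗ h) ⊕ (C (suc s) ⊗ f) ≋ (f ⊗ f) ⊕ C s

  ode : ∀ f m → p ≡ suc (m + m) → f deg< suc m → sum (map (value f) (upTo p)) ≡ p → ODE f m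
  ode f m p≡ f< sum≡p = record
    { s = s ; h = h ; product = product ; der-h = der-h ; equation = equation }
    where
    open ≋-Reasoning
    xs = withMultiplicity (value f) (upTo p)
    F = fromRoots xs
    length≡p : length xs ≡ p
    length≡p = trans (length-withMultiplicity (value f) (upTo p)) sum≡p
    F-deg< : F deg< suc p
    F-deg< = subst (λ n → F deg< suc n) length≡p (proj₁ (fromRoots-monic xs))
    F-top : coeff F p ≈ 1
    F-top = subst (λ n → coeff F n ≈ 1) length≡p (proj₂ (fromRoots-monic xs))
    F′D⊕Ff≋[] : (der F ⊗ D) ⊕ (F ⊗ f) ≋ []
    F′D⊕Ff≋[] = begin
      (der F ⊗ D) ⊕ (F ⊗ f)      ≈⟨ ⊕-congʳ (F ⊗ f) (log-der xs) ⟩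
      (F ⊗ ΣD/ xs) ⊕ (F ⊗ f)     ≈⟨ ⊗-distribˡ-⊕ F (ΣD/ xs) f ⟨
      F ⊗ (ΣD/ xs ⊕ f)
        ≈⟨ ⊗-congˡ F (lagrange f (deg<-mono {f} (subst (suc m ≤_) (sym p≡) (s≤s (m≤m+n m m))) f<)) ⟩
      F ⊗ []                     ≈⟨ ⊗-zeroʳ F ⟩
      []                         ∎
    F′D≋ : der F ⊗ D ≋ ⊖ (F ⊗ f)
    F′D≋ = ⊕-cancelˡ (F ⊗ f) (≋-trans (⊕-comm (F ⊗ f) (der F ⊗ D))
      (≋-trans F′D⊕Ff≋[] (≋-sym (⊕-inverseʳ (F ⊗ f)))))
    F′-deg< : der F deg< suc m
    -- F'D = -Ff has degree at most p + m, and D is monic of degree p.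
    F′-deg< = deg<-cancelʳ (der F) D D-deg< (1≉0 ∘ ≈-trans (≡⇒≈ (sym D-monic)))
      (deg<-cong {⊖ (F ⊗ f)} (≋-sym F′D≋) (deg<-scale (p ∸ 1) (F ⊗ f)
        (deg<-mono {F ⊗ f} (≤-reflexive (cong suc (+-comm p m))) (proj₁ (⊗-top F f F-deg< f<)))))
    h = F ⊕ (⊖ D)
    F≋D⊕h : F ≋ D ⊕ h
    F≋D⊕h = begin
      F                  ≈⟨ ⊕-identityʳ F ⟨
      F ⊕ []             ≈⟨ ⊕-congˡ F (⊕-inverseʳ D) ⟨
      F ⊕ (D ⊕ (⊖ D))    ≈⟨ solve 3 (λ F D n → F :+ (D :+ n) := D :+ (F :+ n)) ≋-refl F D (⊖ D) ⟩
      D ⊕ h              ∎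
    -- For m + 2 ≤ k < p, k times the coefficient of F is a coefficient of F' beyond index m, and k
    -- is invertible. At k = p both polynomials are monic.
    F≈D : ∀ k → suc (suc m) ≤ k → coeff F k ≈ coeff D k
    F≈D k m+2≤k with <-cmp k p
    F≈D (suc k) m+2≤k | tri< k<p k≢p _ = ≈-trans
      (integral≉ (0<·<p⇒≉0 z<s k<p) (≈-trans (≡⇒≈ (sym (coeff-der F k))) (F′-deg< k (s≤s⁻¹ m+2≤k))))
      (≡⇒≈ (sym (trans (coeff-D (suc k) (≤-trans (s≤s (s≤s z≤n)) m+2≤k))
        (coeff-mono-≢ p (suc k) (≢-sym k≢p)))))
    ... | tri≈ _ refl _ = ≈-trans F-top (≡⇒≈ (sym D-monic))
    ... | tri> _ _ p<k = ≈-trans (F-deg< k p<k) (≈-sym (D-deg< k p<k))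
    h-deg< : h deg< suc (suc m)
    h-deg< k le = ≈-trans
      (≡⇒≈ (trans (coeff-⊕ F (⊖ D) k) (cong (coeff F k +_) (coeff-scale (p ∸ 1) D k))))
      (≈-trans (+-congʳ≈ (- coeff D k) (F≈D k le)) (+-inverseʳ (coeff D k)))
    q = der F ⊕ f
    qF≋F′h : q ⊗ F ≋ der F ⊗ h
    qF≋F′h = begin
      (der F ⊕ f) ⊗ F
        ≈⟨ solve 3 (λ F′ f F → (F′ :+ f) :* F := F′ :* F :+ F :* f) ≋-refl (der F) f F ⟩
      (der F ⊗ F) ⊕ (F ⊗ f)
        -- F is replaced by D + h only next to F', so that F'D cancels against Ff.
        ≈⟨ ⊕-congʳ (F ⊗ f) (⊗-congˡ (der F) F≋D⊕h) ⟩
      (der F ⊗ (D ⊕ h)) ⊕ (F ⊗ f)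
        ≈⟨ solve 4 (λ F′ D h Ff → F′ :* (D :+ h) :+ Ff := (F′ :* D :+ Ff) :+ F′ :* h)
             ≋-refl (der F) D h (F ⊗ f) ⟩
      ((der F ⊗ D) ⊕ (F ⊗ f)) ⊕ (der F ⊗ h)
        ≈⟨ ⊕-congʳ (der F ⊗ h) F′D⊕Ff≋[] ⟩
      der F ⊗ h ∎
    s = coeff q 0
    -- qF = F'h has degree at most m + (m + 1) = p, the degree of F, so q has degree 0.
    q≋s : q ≋ C s
    q≋s = deg<1⇒≋C (deg<-cancelʳ q F F-deg< (1≉0 ∘ ≈-trans (≈-sym F-top))
      (deg<-cong {der F ⊗ h} (≋-sym qF≋F′h)
        (deg<-mono {der F ⊗ h} (s≤s (≤-reflexive (trans (+-suc m m) (sym p≡))))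
          (proj₁ (⊗-top (der F) h F′-deg< h-deg<)))))
    product : (C s ⊗ D) ⊕ (f ⊗ h) ≋ []
    -- Adding sh turns sD into sF = qF = F'h, and F'h + fh = qh = sh.
    product = ⊕-cancelˡ (C s ⊗ h) (begin
      (C s ⊗ h) ⊕ ((C s ⊗ D) ⊕ (f ⊗ h))
        ≈⟨ solve 4 (λ s h D f → s :* h :+ (s :* D :+ f :* h) := s :* (D :+ h) :+ f :* h)
             ≋-refl (C s) h D f ⟩
      (C s ⊗ (D ⊕ h)) ⊕ (f ⊗ h)
        ≈⟨ ⊕-congʳ (f ⊗ h) (≋-trans (⊗-cong (≋-sym q≋s) (≋-sym F≋D⊕h)) qF≋F′h) ⟩
      (der F ⊗ h) ⊕ (f ⊗ h)      ≈⟨ ⊗-distribʳ-⊕ h (der F) f ⟨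
      q ⊗ h                      ≈⟨ ⊗-congʳ h q≋s ⟩
      C s ⊗ h                    ≈⟨ ⊕-identityʳ (C s ⊗ h) ⟨
      (C s ⊗ h) ⊕ []             ∎)
    C-suc : ∀ a → C a ⊕ C 1 ≋ C (suc a)
    C-suc a = ∷-cong (≡⇒≈ (+-comm a 1)) ≋-refl
    der-h : der h ⊕ f ≋ C (suc s)
    der-h = begin
      der h ⊕ f                        ≈⟨ ⊕-identityʳ (der h ⊕ f) ⟨
      (der h ⊕ f) ⊕ []                 ≈⟨ ⊕-congˡ (der h ⊕ f) der-D ⟨
      (der h ⊕ f) ⊕ (der D ⊕ C 1)
        ≈⟨ solve 3 (λ h′ f D′ → (h′ :+ f) :+ (D′ :+ con 1) := ((D′ :+ h′) :+ f) :+ con 1)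
             ≋-refl (der h) f (der D) ⟩
      ((der D ⊕ der h) ⊕ f) ⊕ C 1
        ≈⟨ ⊕-congʳ (C 1) (⊕-congʳ f (≋-trans (≋-sym (der-⊕ D h)) (der-cong (≋-sym F≋D⊕h)))) ⟩
      q ⊕ C 1                          ≈⟨ ⊕-congʳ (C 1) q≋s ⟩
      C s ⊕ C 1                        ≈⟨ C-suc s ⟩
      C (suc s)                        ∎
    der-product : (C s ⊗ der D) ⊕ ((der f ⊗ h) ⊕ (f ⊗ der h)) ≋ []
    der-product = begin
      (C s ⊗ der D) ⊕ ((der f ⊗ h) ⊕ (f ⊗ der h))
        ≈⟨ ⊕-cong (≋-sym (≋-trans (der-⊗ (C s) D) (⊕-congʳ (C s ⊗ der D)
             (⊗-congʳ D (0∷[]≋[] {f = []} ≈-refl ≋-refl))))) (≋-sym (der-⊗ f h)) ⟩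
      der (C s ⊗ D) ⊕ der (f ⊗ h)          ≈⟨ der-⊕ (C s ⊗ D) (f ⊗ h) ⟨
      der ((C s ⊗ D) ⊕ (f ⊗ h))            ≈⟨ der-cong product ⟩
      []                                   ∎
    equation : (der f ⊗ h) ⊕ (C (suc s) ⊗ f) ≋ (f ⊗ f) ⊕ C s
    -- The derivative of `product`, with h' = s + 1 - f and D' = -1 inserted.
    equation = begin
      (der f ⊗ h) ⊕ (C (suc s) ⊗ f)
        ≈⟨ ⊕-congˡ (der f ⊗ h) (⊗-congʳ f der-h) ⟨
      (der f ⊗ h) ⊕ ((der h ⊕ f) ⊗ f)
        ≈⟨ ⊕-identityʳ ((der f ⊗ h) ⊕ ((der h ⊕ f) ⊗ f)) ⟨
      ((der f ⊗ h) ⊕ ((der h ⊕ f) ⊗ f)) ⊕ []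
        ≈⟨ ⊕-congˡ ((der f ⊗ h) ⊕ ((der h ⊕ f) ⊗ f))
             (≋-trans (⊗-congˡ (C s) der-D) (⊗-zeroʳ (C s))) ⟨
      ((der f ⊗ h) ⊕ ((der h ⊕ f) ⊗ f)) ⊕ (C s ⊗ (der D ⊕ C 1))
        ≈⟨ solve 6 (λ f′ h h′ f s D′ → (f′ :* h :+ (h′ :+ f) :* f) :+ s :* (D′ :+ con 1)
             := (s :* D′ :+ (f′ :* h :+ f :* h′)) :+ (f :* f :+ s))
             ≋-refl (der f) h (der h) f (C s) (der D) ⟩
      ((C s ⊗ der D) ⊕ ((der f ⊗ h) ⊕ (f ⊗ der h))) ⊕ ((f ⊗ f) ⊕ C s)
        ≈⟨ ⊕-congʳ ((f ⊗ f) ⊕ C s) der-product ⟩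
      (f ⊗ f) ⊕ C s ∎

  -- Pointwise algebra for the differential equation

  evalℕ-C : ∀ a x → evalℕ (C a) x ≡ a
  evalℕ-C a x = trans (cong (a +_) (*-zeroʳ x)) (+-identityʳ a)

  _-C_ : Poly → ℕ → Poly
  f -C r = f ⊕ C (- r)

  -C≋ : ∀ f r → f ≋ (f -C r) ⊕ C r
  -C≋ f r = begin
    f                            ≈⟨ ⊕-identityʳ f ⟨
    f ⊕ []                       ≈⟨ ⊕-congˡ f (⊕-inverseʳ (C r)) ⟨
    f ⊕ (C r ⊕ C (- r))          ≈⟨ solve 3 (λ f r n → f :+ (r :+ n) := (f :+ n) :+ r) ≋-refl f (C r) (C (- r)) ⟩
    (f ⊕ C (- r)) ⊕ C r          ∎
    where open ≋-Reasoning

  evalℕ--C : ∀ f r x → evalℕ (f -C r) x ≡ evalℕ f x + - r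
  evalℕ--C f r x = trans (evalℕ-⊕ f (C (- r)) x) (cong (evalℕ f x +_) (evalℕ-C (- r) x))

  ≈⇒evalℕ--C≈0 : ∀ f r x → evalℕ f x ≈ r → evalℕ (f -C r) x ≈ 0
  ≈⇒evalℕ--C≈0 f r x e = ≈-trans (≡⇒≈ (evalℕ--C f r x)) (≈-trans (+-congʳ≈ (- r) e) (+-inverseʳ r))

  coeff-⊕C : ∀ f r k → 0 < k → coeff (f ⊕ C r) k ≡ coeff f k
  coeff-⊕C f r (suc k) _ = trans (coeff-⊕ f (C r) (suc k)) (+-identityʳ _)

  -C-deg< : ∀ {n} f r → f deg< suc n → (f -C r) deg< suc n
  -C-deg< f r d k n<k = ≈-trans (≡⇒≈ (coeff-⊕C f (- r) k (≤-trans (s≤s z≤n) n<k))) (d k n<k)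

  length-roots≤ : ∀ {n} f xs → f deg< suc n → coeff f n ≉ 0 → Distinct xs →
    All (λ x → evalℕ f x ≈ 0) xs → length xs ≤ n
  length-roots≤ {n} f xs d lead≉0 distinct roots with length xs ≤? n
  ... | yes le = le
  ... | no ¬le = contradiction
    (coeff≈ (manyRoots⇒≋[] f xs distinct roots (deg<-mono {f} (≰⇒> ¬le) d)) n) lead≉0

  der≋[]⇒coeff≈0 : ∀ f {k} → 0 < k → k < p → der f ≋ [] → coeff f k ≈ 0
  der≋[]⇒coeff≈0 f {suc k} _ k<p u = integral≉ (0<·<p⇒≉0 z<s k<p)
    (≈-trans (≡⇒≈ (sym (coeff-der f k))) (coeff≈ u k))

  -- With d = a - 1, the equation (a - 1)(a - s) = 0 becomes d·s = d·(d + 1), to which cancellation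
  -- applies.
  quadratic : ∀ s a → suc s * a ≈ a * a + s → a ≈ 1 ⊎ a ≈ s
  quadratic s a e = conclude (*-cancelˡ≈ d (+-cancelˡ≈ (d + 1 + s) (begin
    d + 1 + s + d * s              ≡⟨ expandˡ d s ⟩
    suc s * (d + 1)                ≈⟨ *-congˡ≈ (suc s) a≈d+1 ⟨
    suc s * a                      ≈⟨ e ⟩
    a * a + s                      ≈⟨ +-congʳ≈ s (*-cong≈ a≈d+1 a≈d+1) ⟩
    (d + 1) * (d + 1) + s          ≡⟨ expandʳ d s ⟩
    d + 1 + s + d * (d + 1)        ∎)))
    where
    open ≈-Reasoning
    d = a + - 1
    a≈d+1 : a ≈ d + 1
    a≈d+1 = ≈-sym (≈-trans (≡⇒≈ (trans (+-assoc a (- 1) 1) (cong (a +_) (+-comm (- 1) 1))))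
      (≈-trans (+-congˡ≈ a (+-inverseʳ 1)) (≡⇒≈ (+-identityʳ a))))
    expandˡ : ∀ d s → d + 1 + s + d * s ≡ suc s * (d + 1)
    expandˡ = solve-∀
    expandʳ : ∀ d s → (d + 1) * (d + 1) + s ≡ d + 1 + s + d * (d + 1)
    expandʳ = solve-∀
    conclude : d ≈ 0 ⊎ s ≈ d + 1 → a ≈ 1 ⊎ a ≈ s
    conclude (inj₁ d≈0) = inj₁ (≈-trans a≈d+1 (+-congʳ≈ 1 d≈0))
    conclude (inj₂ s≈d+1) = inj₂ (≈-trans a≈d+1 (≈-sym s≈d+1))

  -- Here a and y stand for f(x) and f′(x) at a zero x of h.
  critical₁ : ∀ s a y → a ≈ 1 → (suc s + suc s) * y ≈ 3 * (a * y) → y ≈ 0 ⊎ s + s ≈ 1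
  critical₁ s a y a≈1 e = *-cancelˡ≈ y (+-cancelˡ≈ (y + y) (begin
    y + y + y * (s + s)      ≡⟨ lemma s y ⟩
    (suc s + suc s) * y      ≈⟨ e ⟩
    3 * (a * y)              ≈⟨ *-congˡ≈ 3 (*-congʳ≈ y a≈1) ⟩
    3 * (1 * y)              ≡⟨ lemma₁ y ⟩
    y + y + y * 1            ∎))
    where
    open ≈-Reasoning
    lemma : ∀ s y → y + y + y * (s + s) ≡ (suc s + suc s) * y
    lemma = solve-∀
    lemma₁ : ∀ y → 3 * (1 * y) ≡ y + y + y * 1
    lemma₁ = solve-∀

  criticalₛ : ∀ s a y → a ≈ s → (suc s + suc s) * y ≈ 3 * (a * y) → y ≈ 0 ⊎ s ≈ 2
  criticalₛ s a y a≈s e = *-cancelˡ≈ y (+-cancelˡ≈ ((s + s) * y) (begin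
    (s + s) * y + y * s      ≡⟨ lemma₁ s y ⟩
    3 * (s * y)              ≈⟨ *-congˡ≈ 3 (*-congʳ≈ y a≈s) ⟨
    3 * (a * y)              ≈⟨ e ⟨
    (suc s + suc s) * y      ≡⟨ lemma s y ⟨
    (s + s) * y + y * 2      ∎))
    where
    open ≈-Reasoning
    lemma : ∀ s y → (s + s) * y + y * 2 ≡ (suc s + suc s) * y
    lemma = solve-∀
    lemma₁ : ∀ s y → (s + s) * y + y * s ≡ 3 * (s * y)
    lemma₁ = solve-∀

  sign : ∀ r β → β + r ≈ 0 ⊎ β ≈ r → ∃ λ ε → IsSign p ε × β ≈ r * ε
  sign r β (inj₂ β≈r) = 1 , inj₁ refl , ≈-trans β≈r (≡⇒≈ (sym (*-identityʳ r)))
  sign r β (inj₁ β+r≈0) = p ∸ 1 , inj₂ refl , +-cancelˡ≈ r (≈-trans (≡⇒≈ (+-comm r β))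
    (≈-trans β+r≈0 (≈-sym (≈-trans (≡⇒≈ (cong (r +_) (*-comm r (p ∸ 1)))) (+-inverseʳ r)))))

  ⊗-cancelʳ : ∀ {b} f g d → d deg< suc b → coeff d b ≉ 0 → f ⊗ d ≋ g ⊗ d → f ≋ g
  ⊗-cancelʳ f g d d< lead≉0 u = ≋-sym (⊕-cancelˡ (⊖ g) (begin
    (⊖ g) ⊕ g      ≈⟨ ⊕-comm (⊖ g) g ⟩
    g ⊕ (⊖ g)      ≈⟨ ⊕-inverseʳ g ⟩
    []             ≈⟨ deg<0⇒≋[] (deg<-cancelʳ {0} (f ⊕ (⊖ g)) d d< lead≉0
                        (deg<-cong {[]} (≋-sym difference) λ _ _ → ≈-refl)) ⟨
    f ⊕ (⊖ g)      ≈⟨ ⊕-comm f (⊖ g) ⟩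
    (⊖ g) ⊕ f      ∎))
    where
    open ≋-Reasoning
    difference : (f ⊕ (⊖ g)) ⊗ d ≋ []
    difference = begin
      (f ⊕ (⊖ g)) ⊗ d              ≈⟨ ⊗-distribʳ-⊕ d f (⊖ g) ⟩
      (f ⊗ d) ⊕ ((⊖ g) ⊗ d)        ≈⟨ ⊕-cong u (scale-⊗ (p ∸ 1) g d) ⟩
      (g ⊗ d) ⊕ (⊖ (g ⊗ d))        ≈⟨ ⊕-inverseʳ (g ⊗ d) ⟩
      []                           ∎

  der--C : ∀ f r → der (f -C r) ≋ der f
  der--C f r = ≋-trans (der-⊕ f (C (- r)))
    (≋-trans (⊕-congˡ (der f) (0∷[]≋[] {f = []} ≈-refl ≋-refl)) (⊕-identityʳ (der f)))

  -- Here q and k stand for the values at a of the cofactors of (X - a)^j in f - f(a) and of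
  -- X - a in h; the factor 2j + 1 is nonzero in F_p for j < m.
  resonance₁ : ∀ s j q k → s ≈ 2 → k + 1 ≈ suc s → j * (q * k) + suc s * q ≈ (1 + 1) * q →
    suc (j + j) * q ≈ 0
  resonance₁ s j q k s≈2 k+1≈ e = +-cancelˡ≈ (2 * q) (begin
    2 * q + suc (j + j) * q      ≡⟨ lemma j q ⟩
    j * (q * 2) + 3 * q          ≈⟨ +-cong≈ (*-congˡ≈ j (*-congˡ≈ q k≈2))
                                      (*-congʳ≈ q (+-congˡ≈ 1 s≈2)) ⟨
    j * (q * k) + suc s * q      ≈⟨ e ⟩
    (1 + 1) * q                  ≡⟨ +-identityʳ (2 * q) ⟨
    2 * q + 0                    ∎)
    where
    open ≈-Reasoning
    k≈2 : k ≈ 2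
    k≈2 = +-cancelˡ≈ 1 (≈-trans (≡⇒≈ (+-comm 1 k)) (≈-trans k+1≈ (+-congˡ≈ 1 s≈2)))
    lemma : ∀ j q → 2 * q + suc (j + j) * q ≡ j * (q * 2) + 3 * q
    lemma = solve-∀

  resonanceₛ : ∀ s j q k → s + s ≈ 1 → k + s ≈ suc s → j * (q * k) + suc s * q ≈ (s + s) * q →
    suc (j + j) * q ≈ 0
  resonanceₛ s j q k 2s≈1 k+s≈ e = +-cancelˡ≈ (q + q) (begin
    q + q + suc (j + j) * q          ≡⟨ lemma₁ j q ⟩
    q + q + (j + j) * q + 1 * q      ≈⟨ +-congˡ≈ (q + q + (j + j) * q) (*-congʳ≈ q 2s≈1) ⟨
    q + q + (j + j) * q + (s + s) * q ≡⟨ lemma₂ s j q ⟩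
    -- The relation is doubled because s = 1/2 is available only as 2s = 1.
    2 * (j * (q * 1) + suc s * q)
      ≈⟨ *-congˡ≈ 2 (+-congʳ≈ (suc s * q) (*-congˡ≈ j (*-congˡ≈ q k≈1))) ⟨
    2 * (j * (q * k) + suc s * q)    ≈⟨ *-congˡ≈ 2 e ⟩
    2 * ((s + s) * q)                ≈⟨ *-congˡ≈ 2 (*-congʳ≈ q 2s≈1) ⟩
    2 * (1 * q)                      ≡⟨ lemma₃ q ⟩
    q + q + 0                        ∎)
    where
    open ≈-Reasoning
    k≈1 : k ≈ 1
    k≈1 = +-cancelˡ≈ s (≈-trans (≡⇒≈ (+-comm s k)) (≈-trans k+s≈ (≡⇒≈ (+-comm 1 s))))
    lemma₁ : ∀ j q → q + q + suc (j + j) * q ≡ q + q + (j + j) * q + 1 * q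
    lemma₁ = solve-∀
    lemma₂ : ∀ s j q → q + q + (j + j) * q + (s + s) * q ≡ 2 * (j * (q * 1) + suc s * q)
    lemma₂ = solve-∀
    lemma₃ : ∀ q → 2 * (1 * q) ≡ q + q + 0
    lemma₃ = solve-∀

  -- Covers both families: r is 1 or the inverse of 2.
  binomial : ℕ → ℕ → ℕ → ℕ → Poly
  binomial r ε x n = scale r (scale ε (pow (X- x) n) ⊕ (1 ∷ []))

  module OddCharacteristic (m : ℕ) (p≡ : p ≡ suc (m + m)) (0<m : 0 < m) where

    m<p : m < p
    m<p = subst (m <_) (sym p≡) (s≤s (m≤m+n m m))

    2<p : 2 < p
    2<p = subst (2 <_) (sym p≡) (s≤s (+-mono-≤ 0<m 0<m))

    -- From the differential equation to the two families

    module Forward (f : Poly) (f-deg< : f deg< suc m) (lead≉0 : coeff f m ≉ 0)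
                   (sum≡p : sum (map (value f) (upTo p)) ≡ p) (f-ode : ODE f m) where

      open ODE f-ode

      -- D vanishes on all of F_p, so only fh survives when `product` is evaluated.
      fh≈0 : ∀ x → evalℕ f x * evalℕ h x ≈ 0
      fh≈0 x = begin
        evalℕ f x * evalℕ h x
          ≡⟨ cong (_+ evalℕ f x * evalℕ h x) (*-zeroʳ (evalℕ (C s) x)) ⟨
        evalℕ (C s) x * 0 + evalℕ f x * evalℕ h x
          ≈⟨ +-congʳ≈ (evalℕ f x * evalℕ h x) (*-congˡ≈ (evalℕ (C s) x) (evalℕ-D x)) ⟨
        evalℕ (C s) x * evalℕ D x + evalℕ f x * evalℕ h x
          ≡⟨ cong₂ _+_ (evalℕ-⊗ (C s) D x) (evalℕ-⊗ f h x) ⟨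
        evalℕ (C s ⊗ D) x + evalℕ (f ⊗ h) x   ≡⟨ evalℕ-⊕ (C s ⊗ D) (f ⊗ h) x ⟨
        evalℕ ((C s ⊗ D) ⊕ (f ⊗ h)) x         ≈⟨ evalℕ-cong x product ⟩
        0                                     ∎
        where open ≈-Reasoning

      equation-at : ∀ x →
        evalℕ (der f) x * evalℕ h x + suc s * evalℕ f x ≈ evalℕ f x * evalℕ f x + s
      equation-at x = begin
        evalℕ (der f) x * evalℕ h x + suc s * evalℕ f x
          ≡⟨ cong₂ _+_ (evalℕ-⊗ (der f) h x)
               (trans (evalℕ-⊗ (C (suc s)) f x) (cong (_* evalℕ f x) (evalℕ-C (suc s) x))) ⟨
        evalℕ (der f ⊗ h) x + evalℕ (C (suc s) ⊗ f) x
          ≡⟨ evalℕ-⊕ (der f ⊗ h) (C (suc s) ⊗ f) x ⟨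
        evalℕ ((der f ⊗ h) ⊕ (C (suc s) ⊗ f)) x
          ≈⟨ evalℕ-cong x equation ⟩
        evalℕ ((f ⊗ f) ⊕ C s) x
          ≡⟨ evalℕ-⊕ (f ⊗ f) (C s) x ⟩
        evalℕ (f ⊗ f) x + evalℕ (C s) x
          ≡⟨ cong₂ _+_ (evalℕ-⊗ f f x) (evalℕ-C s x) ⟩
        evalℕ f x * evalℕ f x + s ∎
        where open ≈-Reasoning

      h-root⇒value : ∀ x → evalℕ h x ≈ 0 → evalℕ f x ≈ 1 ⊎ evalℕ f x ≈ s
      h-root⇒value x hx = quadratic s (evalℕ f x) (≈-trans
        (+-congʳ≈ (suc s * evalℕ f x) (≈-sym (≈-trans (*-congˡ≈ (evalℕ (der f) x) hx)
          (≡⇒≈ (*-zeroʳ (evalℕ (der f) x))))))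
        (equation-at x))

      values : ∀ x → evalℕ f x ≈ 0 ⊎ (evalℕ f x ≈ 1 ⊎ evalℕ f x ≈ s)
      values x with integral (evalℕ f x) (evalℕ h x) (fh≈0 x)
      ... | inj₁ fx≈0 = inj₁ fx≈0
      ... | inj₂ hx≈0 = inj₂ (h-root⇒value x hx≈0)

      -- The derivative of `equation` with ff' added to both sides: f'h' becomes f'(h' + f) = (s +
      -- 1)f', which eliminates h'.
      der-equation : (der (der f) ⊗ h) ⊕ ((C (suc s) ⊕ C (suc s)) ⊗ der f) ≋
        C 3 ⊗ (f ⊗ der f)
      der-equation = begin
        (der (der f) ⊗ h) ⊕ ((S ⊕ S) ⊗ der f)
          ≈⟨ ⊕-congˡ (der (der f) ⊗ h) (⊗-congʳ (der f) (⊕-congʳ S der-h)) ⟨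
        (der (der f) ⊗ h) ⊕ (((der h ⊕ f) ⊕ S) ⊗ der f)
          ≈⟨ solve 6 (λ f″ h h′ f S f′ → f″ :* h :+ ((h′ :+ f) :+ S) :* f′
               := ((f″ :* h :+ f′ :* h′) :+ S :* f′) :+ f :* f′)
               ≋-refl (der (der f)) h (der h) f S (der f) ⟩
        (((der (der f) ⊗ h) ⊕ (der f ⊗ der h)) ⊕ (S ⊗ der f)) ⊕ (f ⊗ der f)
          ≈⟨ ⊕-congʳ (f ⊗ der f) (≋-trans (≋-sym expandˡ) (≋-trans (der-cong equation) expandʳ)) ⟩
        ((der f ⊗ f) ⊕ (f ⊗ der f)) ⊕ (f ⊗ der f)
          ≈⟨ solve 2 (λ f f′ → (f′ :* f :+ f :* f′) :+ f :* f′ := con 3 :* (f :* f′)) ≋-refl f (der f) ⟩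
        C 3 ⊗ (f ⊗ der f) ∎
        where
        open ≋-Reasoning
        S = C (suc s)
        expandˡ : der ((der f ⊗ h) ⊕ (S ⊗ f)) ≋
          ((der (der f) ⊗ h) ⊕ (der f ⊗ der h)) ⊕ (S ⊗ der f)
        expandˡ = ≋-trans (der-⊕ (der f ⊗ h) (S ⊗ f)) (⊕-cong (der-⊗ (der f) h)
          (≋-trans (der-⊗ S f) (⊕-congʳ (S ⊗ der f) (⊗-congʳ f (0∷[]≋[] {f = []} ≈-refl ≋-refl)))))
        expandʳ : der ((f ⊗ f) ⊕ C s) ≋ (der f ⊗ f) ⊕ (f ⊗ der f)
        expandʳ = ≋-trans (der-⊕ (f ⊗ f) (C s)) (≋-trans
          (⊕-cong (der-⊗ f f) (0∷[]≋[] {f = []} ≈-refl ≋-refl)) (⊕-identityʳ _))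

      der-equation-at : ∀ x → evalℕ h x ≈ 0 →
        (suc s + suc s) * evalℕ (der f) x ≈ 3 * (evalℕ f x * evalℕ (der f) x)
      der-equation-at x hx = begin
        (suc s + suc s) * evalℕ (der f) x
          ≡⟨ cong (_+ (suc s + suc s) * evalℕ (der f) x) (*-zeroʳ (evalℕ (der (der f)) x)) ⟨
        evalℕ (der (der f)) x * 0 + (suc s + suc s) * evalℕ (der f) x
          ≈⟨ +-congʳ≈ ((suc s + suc s) * evalℕ (der f) x) (*-congˡ≈ (evalℕ (der (der f)) x) hx) ⟨
        evalℕ (der (der f)) x * evalℕ h x + (suc s + suc s) * evalℕ (der f) x
          ≡⟨ cong₂ _+_ (evalℕ-⊗ (der (der f)) h x) (trans (evalℕ-⊗ (C (suc s + suc s)) (der f) x)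
               (cong (_* evalℕ (der f) x) (evalℕ-C (suc s + suc s) x))) ⟨
        evalℕ (der (der f) ⊗ h) x + evalℕ (C (suc s + suc s) ⊗ der f) x
          ≡⟨ evalℕ-⊕ (der (der f) ⊗ h) (C (suc s + suc s) ⊗ der f) x ⟨
        evalℕ ((der (der f) ⊗ h) ⊕ (C (suc s + suc s) ⊗ der f)) x
          ≈⟨ evalℕ-cong x der-equation ⟩
        evalℕ (C 3 ⊗ (f ⊗ der f)) x
          ≡⟨ trans (evalℕ-⊗ (C 3) (f ⊗ der f) x) (cong₂ _*_ (evalℕ-C 3 x) (evalℕ-⊗ f (der f) x)) ⟩
        3 * (evalℕ f x * evalℕ (der f) x) ∎
        where open ≈-Reasoning

      der-root : s ≉ 2 → s + s ≉ 1 → ∀ x → evalℕ h x ≈ 0 → evalℕ (der f) x ≈ 0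
      der-root s≉2 2s≉1 x hx = [ at-1 , at-s ]′ (h-root⇒value x hx)
        where
        y = evalℕ (der f) x
        at-1 : evalℕ f x ≈ 1 → y ≈ 0
        at-1 e = [ id , (λ 2s≈1 → contradiction 2s≈1 2s≉1) ]′
          (critical₁ s (evalℕ f x) y e (der-equation-at x hx))
        at-s : evalℕ f x ≈ s → y ≈ 0
        at-s e = [ id , (λ s≈2 → contradiction s≈2 s≉2) ]′
          (criticalₛ s (evalℕ f x) y e (der-equation-at x hx))

      zero? : ∀ x → Dec (evalℕ f x ≈ 0)
      zero? x = evalℕ f x ≈? 0

      zeros≤m : length (filter zero? (upTo p)) ≤ m
      zeros≤m = length-roots≤ f (filter zero? (upTo p)) f-deg< lead≉0
        (AllPairs.filter⁺ zero? upTo-distinct) (All.all-filter zero? (upTo p))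

      nonzeros>m : m < length (filter (¬? ∘ zero?) (upTo p))
      nonzeros>m = +-cancelˡ-≤ m _ _ (begin
        m + suc m                        ≡⟨ trans (+-suc m m) (sym p≡) ⟩
        p                                ≡⟨ length-upTo p ⟨
        length (upTo p)                  ≡⟨ length-filter-¬ zero? (upTo p) ⟨
        length (filter zero? (upTo p)) + length (filter (¬? ∘ zero?) (upTo p))
                                         ≤⟨ +-monoˡ-≤ _ zeros≤m ⟩
        m + length (filter (¬? ∘ zero?) (upTo p)) ∎)
        where open ≤-Reasoning

      -- Otherwise f′ of degree m - 1 would vanish at the m + 1 zeros of h.
      s≈2⊎2s≈1 : s ≈ 2 ⊎ s + s ≈ 1
      s≈2⊎2s≈1 with s ≈? 2 | (s + s) ≈? 1
      ... | yes s≈2 | _ = inj₁ s≈2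
      ... | no _ | yes 2s≈1 = inj₂ 2s≈1
      ... | no s≉2 | no 2s≉1 = contradiction
        (manyRoots⇒≋[] (der f) nonzeros (AllPairs.filter⁺ (¬? ∘ zero?) upTo-distinct)
          (All.map (λ {x} fx≉0 → der-root s≉2 2s≉1 x (integral≉ fx≉0 (fh≈0 x)))
            (All.all-filter (¬? ∘ zero?) (upTo p)))
          (deg<-mono {der f} (<⇒≤ nonzeros>m) (der-deg< f f-deg<)))
        (λ der≋[] → lead≉0 (der≋[]⇒coeff≈0 f 0<m m<p der≋[]))
        where
        nonzeros = filter (¬? ∘ zero?) (upTo p)

      -- The equation for u = f - r shows that u = (X - a)^j q implies q(a) = 0 when j < m.
      module Branch (r a : ℕ) (r≉0 : r ≉ 0) (a-value : evalℕ f a ≈ r)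
        (r-value : suc s * r ≈ r * r + s)
        -- The branches r = 1 and r = s share everything except the last two parameters. `resonance`
        -- solves the linear equation for q(a); in `gap`, β + r is the value of f at a + 1, and the
        -- possible values of f leave only β = r and β = -r.
        (resonance : ∀ j q k → k + r ≈ suc s → j * (q * k) + suc s * q ≈ (r + r) * q →
          suc (j + j) * q ≈ 0)
        (gap : ∀ β → β ≉ 0 → β + r ≈ 0 ⊎ (β + r ≈ 1 ⊎ β + r ≈ s) → β + r ≈ 0 ⊎ β ≈ r) where

        private
          t = X- a
          u = f -C r
          k = quot h a

        h-root : evalℕ h a ≈ 0
        h-root = integral≉ (r≉0 ∘ ≈-trans (≈-sym a-value)) (fh≈0 a)

        -- From h = (X - a)k follows k(a) = h'(a), and h' + f = s + 1 is evaluated at a.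
        k-value : evalℕ k a + r ≈ suc s
        k-value = begin
          evalℕ k a + r
            ≈⟨ +-cong≈ k≈h′ a-value ⟨
          evalℕ (der h) a + evalℕ f a      ≡⟨ evalℕ-⊕ (der h) f a ⟨
          evalℕ (der h ⊕ f) a              ≈⟨ evalℕ-cong a der-h ⟩
          evalℕ (C (suc s)) a              ≡⟨ evalℕ-C (suc s) a ⟩
          suc s                            ∎
          where
          open ≈-Reasoning
          k≈h′ : evalℕ (der h) a ≈ evalℕ k a
          k≈h′ = ≈-trans
            (evalℕ-der-⊗-root {h} {t} {k} {a} (root⇒factor h a h-root) (evalℕ-X-≈0 a))
            (≡⇒≈ (trans (cong (_* evalℕ k a) (evalℕ-der-X- a a)) (*-identityˡ _)))

        -- Substituting f = u + r leaves the constants (s + 1)r and r² + s, equal by `r-value`.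
        -- Without a constant term, powers of X - a can be divided out.
        u-equation : (der u ⊗ h) ⊕ (C (suc s) ⊗ u) ≋ (u ⊗ u) ⊕ ((C r ⊕ C r) ⊗ u)
        u-equation = ⊕-cancelˡ (C (suc s) ⊗ C r) (begin
          (S ⊗ R) ⊕ ((der u ⊗ h) ⊕ (S ⊗ u))
            ≈⟨ solve 4 (λ S R v u → S :* R :+ (v :+ S :* u) := v :+ S :* (u :+ R))
                 ≋-refl S R (der u ⊗ h) u ⟩
          (der u ⊗ h) ⊕ (S ⊗ (u ⊕ R))
            ≈⟨ ⊕-cong (⊗-congʳ h (der--C f r)) (⊗-congˡ S (≋-sym (-C≋ f r))) ⟩
          (der f ⊗ h) ⊕ (S ⊗ f)
            ≈⟨ equation ⟩
          (f ⊗ f) ⊕ C s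
            ≈⟨ ⊕-congʳ (C s) (⊗-cong (-C≋ f r) (-C≋ f r)) ⟩
          ((u ⊕ R) ⊗ (u ⊕ R)) ⊕ C s
            ≈⟨ solve 3 (λ u R s → (u :+ R) :* (u :+ R) :+ s := (R :* R :+ s) :+ (u :* u :+ (R :+ R) :* u))
                 ≋-refl u R (C s) ⟩
          ((R ⊗ R) ⊕ C s) ⊕ ((u ⊗ u) ⊕ ((R ⊕ R) ⊗ u))
            ≈⟨ ⊕-congʳ ((u ⊗ u) ⊕ ((R ⊕ R) ⊗ u)) constants ⟨
          (S ⊗ R) ⊕ ((u ⊗ u) ⊕ ((R ⊕ R) ⊗ u)) ∎)
          where
          open ≋-Reasoning
          S = C (suc s)
          R = C r
          constants : S ⊗ R ≋ (R ⊗ R) ⊕ C s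
          constants = ∷-cong (≈-trans (≡⇒≈ (+-identityʳ (suc s * r))) (≈-trans r-value
            (≡⇒≈ (cong (_+ s) (sym (+-identityʳ (r * r))))))) ≋-refl

        -- Differentiating (X - a)^j q loses one factor X - a, but the root a of h restores it;
        -- hence every term of `u-equation` is divisible by (X - a)^j.
        quotient-equation : ∀ j q → u ≋ pow t j ⊗ q →
          ((C j ⊗ (q ⊗ k)) ⊕ (t ⊗ (der q ⊗ k))) ⊕ (C (suc s) ⊗ q) ≋ (q ⊗ u) ⊕ ((C r ⊕ C r) ⊗ q)
        quotient-equation j q u≋ = ⊗-cancelʳ _ _ T (proj₁ (pow-monic (- a) j))
          (1≉0 ∘ ≈-trans (≈-sym (proj₂ (pow-monic (- a) j)))) (begin
          (((C j ⊗ (q ⊗ k)) ⊕ (t ⊗ (der q ⊗ k))) ⊕ (S ⊗ q)) ⊗ T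
            ≈⟨ solve 7 (λ j q k t q′ S T → ((j :* (q :* k) :+ t :* (q′ :* k)) :+ S :* q) :* T
                 := ((j :* T) :* (q :* k) :+ (T :* q′) :* (t :* k)) :+ S :* (T :* q))
                 ≋-refl (C j) q k t (der q) S T ⟩
          (((C j ⊗ T) ⊗ (q ⊗ k)) ⊕ ((T ⊗ der q) ⊗ (t ⊗ k))) ⊕ (S ⊗ (T ⊗ q))
            ≈⟨ ⊕-congʳ (S ⊗ (T ⊗ q)) (⊕-congʳ ((T ⊗ der q) ⊗ (t ⊗ k)) (⊗-congʳ (q ⊗ k) tT′)) ⟨
          (((t ⊗ der T) ⊗ (q ⊗ k)) ⊕ ((T ⊗ der q) ⊗ (t ⊗ k))) ⊕ (S ⊗ (T ⊗ q))
            ≈⟨ ⊕-congʳ (S ⊗ (T ⊗ q)) (solve 6 (λ t T′ q k T q′ →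
                 (t :* T′) :* (q :* k) :+ (T :* q′) :* (t :* k) := (T′ :* q :+ T :* q′) :* (t :* k))
                 ≋-refl t (der T) q k T (der q)) ⟩
          (((der T ⊗ q) ⊕ (T ⊗ der q)) ⊗ (t ⊗ k)) ⊕ (S ⊗ (T ⊗ q))
            ≈⟨ ⊕-cong (⊗-cong (≋-trans (der-cong u≋) (der-⊗ T q)) (root⇒factor h a h-root))
                 (⊗-congˡ S u≋) ⟨
          (der u ⊗ h) ⊕ (S ⊗ u)
            ≈⟨ u-equation ⟩
          (u ⊗ u) ⊕ ((R ⊕ R) ⊗ u)
            ≈⟨ ⊕-cong (⊗-congʳ u u≋) (⊗-congˡ (R ⊕ R) u≋) ⟩
          ((T ⊗ q) ⊗ u) ⊕ ((R ⊕ R) ⊗ (T ⊗ q))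
            ≈⟨ solve 4 (λ T q u R → (T :* q) :* u :+ (R :+ R) :* (T :* q)
                 := (q :* u :+ (R :+ R) :* q) :* T) ≋-refl T q u R ⟩
          ((q ⊗ u) ⊕ ((R ⊕ R) ⊗ q)) ⊗ T ∎)
          where
          open ≋-Reasoning
          S = C (suc s)
          R = C r
          T = pow t j
          tT′ : t ⊗ der T ≋ C j ⊗ T
          tT′ = ≋-trans (der-pow t j) (⊗-congˡ (C j) (≋-trans (⊗-congˡ T (der-X- a))
            (≋-trans (⊗-comm T (C 1)) (⊗-identityˡ T))))

        quotient-root : ∀ j q → j < m → u ≋ pow t j ⊗ q → evalℕ q a ≈ 0
        quotient-root j q j<m u≋ = integral≉ {suc (j + j)}
          (0<·<p⇒≉0 z<s (subst (suc (j + j) <_) (sym p≡) (s≤s (+-mono-< j<m j<m))))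
          -- At a both X - a and u vanish, so the quotient equation becomes linear in q(a).
          (resonance j q₀ k₀ k-value (begin
            j * (q₀ * k₀) + suc s * q₀
              ≡⟨ cong (_+ suc s * q₀) (+-identityʳ (j * (q₀ * k₀))) ⟨
            j * (q₀ * k₀) + 0 * evalℕ (der q ⊗ k) a + suc s * q₀
              ≈⟨ +-congʳ≈ (suc s * q₀) (+-congˡ≈ (j * (q₀ * k₀))
                   (*-congʳ≈ (evalℕ (der q ⊗ k) a) (evalℕ-X-≈0 a))) ⟨
            j * (q₀ * k₀) + evalℕ t a * evalℕ (der q ⊗ k) a + suc s * q₀
              ≡⟨ left ⟨
            evalℕ (((C j ⊗ (q ⊗ k)) ⊕ (t ⊗ (der q ⊗ k))) ⊕ (C (suc s) ⊗ q)) a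
              ≈⟨ evalℕ-cong a (quotient-equation j q u≋) ⟩
            evalℕ ((q ⊗ u) ⊕ (C (r + r) ⊗ q)) a
              ≡⟨ right ⟩
            q₀ * evalℕ u a + (r + r) * q₀
              ≈⟨ +-congʳ≈ ((r + r) * q₀) (*-congˡ≈ q₀ (≈⇒evalℕ--C≈0 f r a a-value)) ⟩
            q₀ * 0 + (r + r) * q₀
              ≡⟨ cong (_+ (r + r) * q₀) (*-zeroʳ q₀) ⟩
            (r + r) * q₀ ∎))
          where
          open ≈-Reasoning
          q₀ = evalℕ q a
          k₀ = evalℕ k a
          evalℕ-C⊗ : ∀ c g → evalℕ (C c ⊗ g) a ≡ c * evalℕ g a
          evalℕ-C⊗ c g = trans (evalℕ-⊗ (C c) g a) (cong (_* evalℕ g a) (evalℕ-C c a))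
          left : evalℕ (((C j ⊗ (q ⊗ k)) ⊕ (t ⊗ (der q ⊗ k))) ⊕ (C (suc s) ⊗ q)) a ≡
            j * (q₀ * k₀) + evalℕ t a * evalℕ (der q ⊗ k) a + suc s * q₀
          left = trans (evalℕ-⊕ ((C j ⊗ (q ⊗ k)) ⊕ (t ⊗ (der q ⊗ k))) (C (suc s) ⊗ q) a) (cong₂ _+_
            (trans (evalℕ-⊕ (C j ⊗ (q ⊗ k)) (t ⊗ (der q ⊗ k)) a) (cong₂ _+_
              (trans (evalℕ-C⊗ j (q ⊗ k)) (cong (j *_) (evalℕ-⊗ q k a)))
              (evalℕ-⊗ t (der q ⊗ k) a)))
            (evalℕ-C⊗ (suc s) q))
          right : evalℕ ((q ⊗ u) ⊕ (C (r + r) ⊗ q)) a ≡ q₀ * evalℕ u a + (r + r) * q₀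
          right = trans (evalℕ-⊕ (q ⊗ u) (C (r + r) ⊗ q) a)
            (cong₂ _+_ (evalℕ-⊗ q u a) (evalℕ-C⊗ (r + r) q))

        power-factor : ∀ j → j ≤ m → Σ Poly λ q → u ≋ pow t j ⊗ q
        power-factor zero _ = u , ≋-sym (⊗-identityˡ u)
        power-factor (suc j) j<m with power-factor j (<⇒≤ j<m)
        ... | q , u≋ = quot q a , ≋-trans u≋ (≋-trans
          (⊗-congˡ (pow t j) (root⇒factor q a (quotient-root j q j<m u≋)))
          (solve 3 (λ T t q → T :* (t :* q) := (t :* T) :* q) ≋-refl (pow t j) t (quot q a)))

        conclusion : Σ ℕ λ ε → IsSign p ε × f ≋ binomial r ε a m
        conclusion with power-factor m ≤-refl
        ... | q , u≋ = finish (sign r β (gap β β≉0 β-values))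
          where
          T = pow t m
          β = coeff q 0
          u≋βT : u ≋ scale β T
          -- u has degree at most m and (X - a)^m is monic of degree m, so the cofactor is a
          -- constant.
          u≋βT = ≋-trans u≋ (≋-trans (⊗-comm T q) (≋-trans (⊗-congʳ T (deg<1⇒≋C {q}
            (deg<-cancelʳ q T (proj₁ (pow-monic (- a) m)) (1≉0 ∘ ≈-trans (≈-sym (proj₂ (pow-monic (- a) m))))
              (deg<-cong {u} (≋-trans u≋ (⊗-comm T q)) (-C-deg< f r f-deg<)))))
            (≋-sym (scale≋C⊗ β T))))
          f≋ : f ≋ scale β T ⊕ C r
          f≋ = ≋-trans (-C≋ f r) (⊕-congʳ (C r) u≋βT)
          β≉0 : β ≉ 0
          β≉0 β≈0 = lead≉0 (begin
            coeff f m                    ≈⟨ coeff≈ f≋ m ⟩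
            coeff (scale β T ⊕ C r) m    ≡⟨ coeff-⊕C (scale β T) r m 0<m ⟩
            coeff (scale β T) m          ≡⟨ coeff-scale β T m ⟩
            β * coeff T m                ≈⟨ *-congʳ≈ (coeff T m) β≈0 ⟩
            0                            ∎)
            where open ≈-Reasoning
          -- X - a is 1 at a + 1, which exposes β in a value of f, and few values are possible.
          value-a+1 : evalℕ f (suc a) ≈ β + r
          value-a+1 = begin
            evalℕ f (suc a)
              ≈⟨ evalℕ-cong (suc a) f≋ ⟩
            evalℕ (scale β T ⊕ C r) (suc a)
              ≡⟨ evalℕ-⊕ (scale β T) (C r) (suc a) ⟩
            evalℕ (scale β T) (suc a) + evalℕ (C r) (suc a)
              ≡⟨ cong₂ _+_ (trans (evalℕ-scale β T (suc a)) (cong (β *_) (evalℕ-pow t m (suc a))))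
                   (evalℕ-C r (suc a)) ⟩
            β * evalℕ t (suc a) ^ m + r
              ≈⟨ +-congʳ≈ r (*-congˡ≈ β (^-cong≈ m t≈1)) ⟩
            β * 1 ^ m + r
              ≡⟨ cong (_+ r) (trans (cong (β *_) (^-zeroˡ m)) (*-identityʳ β)) ⟩
            β + r ∎
            where
            open ≈-Reasoning
            t≈1 : evalℕ t (suc a) ≈ 1
            t≈1 = ≈-trans (≡⇒≈ (trans (evalℕ-X- a (suc a)) (+-comm (- a) (suc a))))
              (+-congˡ≈ 1 (+-inverseʳ a))
          β-values : β + r ≈ 0 ⊎ (β + r ≈ 1 ⊎ β + r ≈ s)
          β-values = Sum.map transport (Sum.map transport transport) (values (suc a))
            where
            transport : ∀ {c} → evalℕ f (suc a) ≈ c → β + r ≈ c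
            transport = ≈-trans (≈-sym value-a+1)
          finish : (∃ λ ε → IsSign p ε × β ≈ r * ε) → Σ ℕ λ ε → IsSign p ε × f ≋ binomial r ε a m
          finish (ε , ε-sign , β≈rε) = ε , ε-sign , (begin
            f                                  ≈⟨ f≋ ⟩
            scale β T ⊕ C r
              ≈⟨ ⊕-cong (scale-cong {f = T} β≈rε ≋-refl) (∷-cong (≡⇒≈ (sym (*-identityʳ r))) ≋-refl) ⟩
            scale (r * ε) T ⊕ scale r (C 1)    ≈⟨ ⊕-congʳ (scale r (C 1)) (scale-scale r ε T) ⟨
            scale r (scale ε T) ⊕ scale r (C 1) ≈⟨ scale-⊕ r (scale ε T) (C 1) ⟨
            binomial r ε a m                   ∎)
            where open ≋-Reasoning

      classification₁ : s ≈ 2 → ∃ λ a → a < p × Σ ℕ λ ε → IsSign p ε × f ≋ binomial 1 ε a m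
      classification₁ s≈2 with Any.any? (λ x → evalℕ f x ≈? 1) (upTo p)
      ... | yes any = witness (find any)
        where
        gap : ∀ β → β ≉ 0 → β + 1 ≈ 0 ⊎ (β + 1 ≈ 1 ⊎ β + 1 ≈ s) → β + 1 ≈ 0 ⊎ β ≈ 1
        gap β β≉0 (inj₁ e) = inj₁ e
        gap β β≉0 (inj₂ (inj₁ e)) = contradiction (+-cancelˡ≈ 1 (≈-trans (≡⇒≈ (+-comm 1 β)) e)) β≉0
        gap β β≉0 (inj₂ (inj₂ e)) =
          inj₂ (+-cancelˡ≈ 1 (≈-trans (≡⇒≈ (+-comm 1 β)) (≈-trans e s≈2)))
        witness : ∃ (λ a → a ∈ upTo p × evalℕ f a ≈ 1) → _
        witness (a , a∈ , fa≈1) = a , ∈-upTo⁻ a∈ ,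
          Branch.conclusion 1 a 1≉0 fa≈1 (≡⇒≈ (*-identityʳ (suc s)))
            (λ j q k → resonance₁ s j q k s≈2) gap
      -- If 1 is never attained, all values are 0 or 2 and their sum is even, but the sum is p = 2m
      -- + 1.
      ... | no ¬any = contradiction even odd
        where
        value-even : ∀ {x} → x ∈ upTo p → 2 ∣ value f x
        value-even {x} x∈ with values x
        ... | inj₁ e = subst (2 ∣_) (sym (trans (residue≡ e) 0%p≡0)) (2 ∣0)
        ... | inj₂ (inj₁ e) = contradiction (lose x∈ e) ¬any
        ... | inj₂ (inj₂ e) = subst (2 ∣_)
          (sym (trans (residue≡ (≈-trans e s≈2)) (m<n⇒m%n≡m 2<p))) ∣-refl
        even : 2 ∣ suc (m + m)
        even = subst (2 ∣_) (trans sum≡p p≡)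
          (∣-sum-map 2 (value f) (upTo p) (All.tabulate value-even))
        odd : ¬ (2 ∣ suc (m + m))
        odd d = >⇒∤ (s≤s (s≤s z≤n)) (∣m+n∣m⇒∣n {2} {m + m} {1} (subst (2 ∣_) (+-comm 1 (m + m)) d)
          (subst (2 ∣_) (cong (m +_) (+-identityʳ m)) (m∣m*n m)))

      classificationₛ : s + s ≈ 1 → ∃ λ a → a < p × Σ ℕ λ ε → IsSign p ε × f ≋ binomial s ε a m
      classificationₛ 2s≈1 with Any.any? (λ x → evalℕ f x ≈? s) (upTo p)
      ... | yes any = witness (find any)
        where
        gap : ∀ β → β ≉ 0 → β + s ≈ 0 ⊎ (β + s ≈ 1 ⊎ β + s ≈ s) → β + s ≈ 0 ⊎ β ≈ s
        gap β β≉0 (inj₁ e) = inj₁ e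
        gap β β≉0 (inj₂ (inj₁ e)) =
          inj₂ (+-cancelˡ≈ s (≈-trans (≡⇒≈ (+-comm s β)) (≈-trans e (≈-sym 2s≈1))))
        gap β β≉0 (inj₂ (inj₂ e)) = contradiction
          (+-cancelˡ≈ s (≈-trans (≡⇒≈ (+-comm s β)) (≈-trans e (≡⇒≈ (sym (+-identityʳ s)))))) β≉0
        s≉0 : s ≉ 0
        s≉0 s≈0 = 1≉0 (≈-trans (≈-sym 2s≈1) (+-cong≈ s≈0 s≈0))
        witness : ∃ (λ a → a ∈ upTo p × evalℕ f a ≈ s) → _
        witness (a , a∈ , fa≈s) = a , ∈-upTo⁻ a∈ ,
          Branch.conclusion s a s≉0 fa≈s (≡⇒≈ (+-comm s (s * s)))
            (λ j q k → resonanceₛ s j q k 2s≈1) gap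
      -- If s is never attained, all values are at most 1; with sum p they are all 1, and f - 1, of
      -- degree at most m, has p roots.
      ... | no ¬any = contradiction
        (≈-trans (≡⇒≈ (sym (coeff-⊕C f (- 1) m 0<m)))
          (coeff≈ (manyRoots⇒≋[] (f -C 1) (upTo p) upTo-distinct (All.map (λ {x} → f-1-root {x}) all≡1)
            (subst ((f -C 1) deg<_) (sym (length-upTo p)) (deg<-mono {f -C 1} m<p (-C-deg< f 1 f-deg<)))) m))
        lead≉0
        where
        value≤1 : ∀ {x} → x ∈ upTo p → value f x ≤ 1
        value≤1 {x} x∈ with values x
        ... | inj₁ e = ≤-trans (≤-reflexive (trans (residue≡ e) 0%p≡0)) z≤n
        ... | inj₂ (inj₁ e) = ≤-reflexive (trans (residue≡ e) (m<n⇒m%n≡m 2≤p))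
        ... | inj₂ (inj₂ e) = contradiction (lose x∈ e) ¬any
        all≡1 : All (λ x → value f x ≡ 1) (upTo p)
        all≡1 = sum-map≡length⇒≡1 (value f) (upTo p) (All.tabulate value≤1)
          (trans sum≡p (sym (length-upTo p)))
        f-1-root : ∀ {x} → value f x ≡ 1 → evalℕ (f -C 1) x ≈ 0
        f-1-root {x} e = ≈⇒evalℕ--C≈0 f 1 x (≈-trans (≈-sym (%-≈ (evalℕ f x))) (≡⇒≈ e))

    -- The converse: counting the values of the two families

    sign²≈1 : ∀ {ε} → IsSign p ε → ε * ε ≈ 1
    sign²≈1 (inj₁ refl) = ≈-refl
    sign²≈1 (inj₂ refl) = +-cancelˡ≈ e (≈-trans (≡⇒≈ (lemma e))
      (≈-trans (*-congˡ≈ e e+1≈0) (≈-trans (≡⇒≈ (*-zeroʳ e)) (≈-sym e+1≈0))))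
      where
      e = p ∸ 1
      e+1≈0 : e + 1 ≈ 0
      e+1≈0 = ≈-trans (≡⇒≈ (trans (+-comm e 1) suc[p∸1]≡p)) p≈0
      lemma : ∀ e → e + e * e ≡ e * (e + 1)
      lemma = solve-∀

    ±1 : ∀ w → w * w ≈ 1 → w + 1 ≈ 0 ⊎ w ≈ 1
    ±1 w w²≈1 = *-cancelˡ≈ (w + 1) (begin
      (w + 1) * w      ≡⟨ lemma w ⟩
      w + w * w        ≈⟨ +-congˡ≈ w w²≈1 ⟩
      w + 1            ≡⟨ *-identityʳ (w + 1) ⟨
      (w + 1) * 1      ∎)
      where
      open ≈-Reasoning
      lemma : ∀ w → (w + 1) * w ≡ w + w * w
      lemma = solve-∀

    -- Fermat's theorem with one of the p = 1 + 2m factors cancelled.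
    half-power²≈1 : ∀ y → y ≉ 0 → y ^ m * y ^ m ≈ 1
    half-power²≈1 y y≉0 = conclude (*-cancelˡ≈ y (begin
      y * (y ^ m * y ^ m)      ≡⟨ cong (y *_) (^-distribˡ-+-* y m m) ⟨
      y ^ suc (m + m)          ≡⟨ cong (y ^_) p≡ ⟨
      y ^ p                    ≈⟨ fermat y ⟩
      y                        ≡⟨ *-identityʳ y ⟨
      y * 1                    ∎))
      where
      open ≈-Reasoning
      conclude : y ≈ 0 ⊎ y ^ m * y ^ m ≈ 1 → y ^ m * y ^ m ≈ 1
      conclude (inj₁ y≈0) = contradiction y≈0 y≉0
      conclude (inj₂ e) = e

    -- A and B are the reduced representatives of r and 2r, the values of f at a and where ε(X -
    -- a)^m is 1; the remaining value is 0. The pair (A, B) is (1, 2) in one family and (m + 1, 1)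
    -- in the other, and A + mB = p in both.
    module Converse (f : Poly) (f-deg< : f deg< suc m) (r ε a A B : ℕ) (ε-sign : IsSign p ε)
      (f≋ : f ≋ binomial r ε a m) (r≈A : r ≈ A) (2r≈B : r + r ≈ B)
      (A<p : A < p) (B<p : B < p) (A≢B : A ≢ B) (A≢0 : A ≢ 0) (B≢0 : B ≢ 0) where

      private
        t = X- a
        T = pow t m
        v = value f

      -- The leading coefficient is rε, and a further factor ε gives back r.
      coeff-m≉0 : coeff f m ≉ 0
      coeff-m≉0 e = A≢0 (<p⇒≡ A<p (<-trans z<s 2≤p) (≈-trans (≈-sym r≈A) r≈0))
        where
        rε≈0 : r * ε ≈ 0
        rε≈0 = begin
          r * ε                            ≡⟨ cong (r *_) (*-identityʳ ε) ⟨
          r * (ε * 1)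
            ≈⟨ *-congˡ≈ r (*-congˡ≈ ε (proj₂ (pow-monic (- a) m))) ⟨
          r * (ε * coeff T m)              ≡⟨ cong (r *_) (coeff-scale ε T m) ⟨
          r * coeff (scale ε T) m          ≡⟨ cong (r *_) (coeff-⊕C (scale ε T) 1 m 0<m) ⟨
          r * coeff (scale ε T ⊕ C 1) m    ≡⟨ coeff-scale r (scale ε T ⊕ C 1) m ⟨
          coeff (binomial r ε a m) m       ≈⟨ coeff≈ f≋ m ⟨
          coeff f m                        ≈⟨ e ⟩
          0                                ∎
          where open ≈-Reasoning
        r≈0 : r ≈ 0
        r≈0 = begin
          r              ≡⟨ *-identityʳ r ⟨
          r * 1          ≈⟨ *-congˡ≈ r (sign²≈1 ε-sign) ⟨
          r * (ε * ε)    ≡⟨ *-assoc r ε ε ⟨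
          r * ε * ε      ≈⟨ *-congʳ≈ ε rε≈0 ⟩
          0              ∎
          where open ≈-Reasoning

      evalℕ-f : ∀ x → evalℕ f x ≈ r * (ε * evalℕ t x ^ m + 1)
      evalℕ-f x = begin
        evalℕ f x                              ≈⟨ evalℕ-cong x f≋ ⟩
        evalℕ (binomial r ε a m) x             ≡⟨ evalℕ-scale r (scale ε T ⊕ C 1) x ⟩
        r * evalℕ (scale ε T ⊕ C 1) x          ≡⟨ cong (r *_) (evalℕ-⊕ (scale ε T) (C 1) x) ⟩
        r * (evalℕ (scale ε T) x + evalℕ (C 1) x)
          ≡⟨ cong (r *_) (cong₂ _+_ (trans (evalℕ-scale ε T x) (cong (ε *_) (evalℕ-pow t m x)))
               (evalℕ-C 1 x)) ⟩
        r * (ε * evalℕ t x ^ m + 1)            ∎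
        where open ≈-Reasoning

      f-at-a : ∀ x → evalℕ t x ≈ 0 → evalℕ f x ≈ A
      f-at-a x tx≈0 = begin
        evalℕ f x                      ≈⟨ evalℕ-f x ⟩
        r * (ε * evalℕ t x ^ m + 1)
          ≈⟨ *-congˡ≈ r (+-congʳ≈ 1 (*-congˡ≈ ε (^-cong≈ m tx≈0))) ⟩
        r * (ε * 0 ^ m + 1)
          ≡⟨ cong (λ n → r * (ε * n + 1)) (0^n≡0 m 0<m) ⟩
        r * (ε * 0 + 1)                ≡⟨ cong (λ n → r * (n + 1)) (*-zeroʳ ε) ⟩
        r * 1                          ≡⟨ *-identityʳ r ⟩
        r                              ≈⟨ r≈A ⟩
        A                              ∎
        where
        open ≈-Reasoning
        0^n≡0 : ∀ n → 0 < n → 0 ^ n ≡ 0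
        0^n≡0 (suc n) _ = refl

      f-off-a : ∀ x → evalℕ t x ≉ 0 → evalℕ f x ≈ B ⊎ evalℕ f x ≈ 0
      f-off-a x tx≉0 = conclude (±1 w (begin
        w * w                          ≡⟨ lemma ε y ⟩
        (ε * ε) * (y * y)              ≈⟨ *-cong≈ (sign²≈1 ε-sign) (half-power²≈1 (evalℕ t x) tx≉0) ⟩
        1                              ∎))
        where
        open ≈-Reasoning
        y = evalℕ t x ^ m
        w = ε * y
        lemma : ∀ ε y → ε * y * (ε * y) ≡ (ε * ε) * (y * y)
        lemma = solve-∀
        double : ∀ r → r * (1 + 1) ≡ r + r
        double = solve-∀
        conclude : w + 1 ≈ 0 ⊎ w ≈ 1 → evalℕ f x ≈ B ⊎ evalℕ f x ≈ 0
        conclude (inj₁ w+1≈0) = inj₂ (≈-trans (evalℕ-f x)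
          (≈-trans (*-congˡ≈ r w+1≈0) (≡⇒≈ (*-zeroʳ r))))
        conclude (inj₂ w≈1) = inj₁ (≈-trans (evalℕ-f x)
          (≈-trans (*-congˡ≈ r (+-congʳ≈ 1 w≈1)) (≈-trans (≡⇒≈ (double r)) 2r≈B)))

      ≈⇒value : ∀ {x c} → c < p → evalℕ f x ≈ c → v x ≡ c
      ≈⇒value {c = c} c<p e = trans (residue≡ e) (m<n⇒m%n≡m c<p)

      value⇒≈ : ∀ {x c} → v x ≡ c → evalℕ f x ≈ c
      value⇒≈ {x} e = ≈-trans (≈-sym (%-≈ (evalℕ f x))) (≡⇒≈ e)

      0<p : 0 < p
      0<p = <-trans z<s 2≤p

      three-values : ∀ x → v x ≡ A ⊎ (v x ≡ B ⊎ v x ≡ 0)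
      three-values x with evalℕ t x ≈? 0
      ... | yes tx≈0 = inj₁ (≈⇒value {x} A<p (f-at-a x tx≈0))
      ... | no tx≉0 = inj₂ (Sum.map (≈⇒value {x} B<p) (≈⇒value {x} 0<p) (f-off-a x tx≉0))

      value≡A⇒root : ∀ {x} → v x ≡ A → evalℕ t x ≈ 0
      value≡A⇒root {x} e with evalℕ t x ≈? 0
      ... | yes tx≈0 = tx≈0
      ... | no tx≉0 with f-off-a x tx≉0
      ...   | inj₁ fx≈B = contradiction (trans (sym e) (≈⇒value {x} B<p fx≈B)) A≢B
      ...   | inj₂ fx≈0 = contradiction (trans (sym e) (≈⇒value {x} 0<p fx≈0)) A≢0

      #A≤1 : (# v) A (upTo p) ≤ 1
      #A≤1 = length-roots≤ {1} t (filter (λ x → v x ≟ A) (upTo p))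
        (λ { (suc zero) (s≤s ()) ; (suc (suc k)) _ → ≈-refl }) 1≉0
        (AllPairs.filter⁺ (λ x → v x ≟ A) upTo-distinct)
        (All.map (λ {x} → value≡A⇒root {x}) (All.all-filter (λ x → v x ≟ A) (upTo p)))

      -- These are zeros of f - c, which has the leading coefficient of f because m > 0.
      #≤m : ∀ c → (# v) c (upTo p) ≤ m
      #≤m c = length-roots≤ (f -C c) (filter (λ x → v x ≟ c) (upTo p)) (-C-deg< f c f-deg<)
        (coeff-m≉0 ∘ ≈-trans (≡⇒≈ (sym (coeff-⊕C f (- c) m 0<m))))
        (AllPairs.filter⁺ (λ x → v x ≟ c) upTo-distinct)
        (All.map (λ {x} e → ≈⇒evalℕ--C≈0 f c x (value⇒≈ {x} e)) (All.all-filter (λ x → v x ≟ c) (upTo p)))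

      #-total : (# v) A (upTo p) + ((# v) B (upTo p) + (# v) 0 (upTo p)) ≡ suc (m + m)
      #-total = trans (length-three-values v A≢B A≢0 B≢0 (upTo p) (All.tabulate λ {x} _ → three-values x))
        (trans (length-upTo p) p≡)

      -- The three upper bounds add up to the total, so none of them can be strict.
      #A≡1×#B≡m : ∀ {i j k} → i ≤ 1 → j ≤ m → k ≤ m → i + (j + k) ≡ suc (m + m) → i ≡ 1 × j ≡ m
      #A≡1×#B≡m {i} {j} {k} i≤1 j≤m k≤m total =
        ≤-antisym i≤1 (+-cancelʳ-≤ (m + m) 1 i (≤-trans (≤-reflexive (sym total)) (+-monoʳ-≤ i (+-mono-≤ j≤m k≤m)))) ,
        ≤-antisym j≤m (+-cancelʳ-≤ m m j (≤-trans
          (s≤s⁻¹ (≤-trans (≤-reflexive (sym total)) (+-monoˡ-≤ (j + k) i≤1))) (+-monoʳ-≤ j k≤m)))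

      sum-values : sum (map v (upTo p)) ≡ A + m * B
      sum-values with #A≡1×#B≡m #A≤1 (#≤m B) (#≤m 0) #-total
      ... | #A≡1 , #B≡m =
        trans (sum-three-values v A≢B A≢0 B≢0 (upTo p) (All.tabulate λ {x} _ → three-values x))
          (cong₂ _+_ (trans (cong (_* A) #A≡1) (*-identityˡ A)) (cong (_* B) #B≡m))

  -- Oddness of p and the passage to coefficient functions

  odd : 2 < p → p ≡ suc (half p + half p)
  odd 2<p = trans (sym suc[p∸1]≡p) (cong suc (trans (m≡m%n+[m/n]*n (p ∸ 1) 2)
    (trans (cong (_+ half p * 2) (%-parity (p ∸ 1) (subst (λ n → ¬ 2 ∣ n) (sym suc[p∸1]≡p) 2∤p)))
      (trans (*-comm (half p) 2) (cong (half p +_) (+-identityʳ (half p)))))))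
    where
    2∤p : ¬ 2 ∣ p
    2∤p d with prime⇒irreducible p-prime d
    ... | inj₂ 2≡p = <⇒≢ 2<p 2≡p
    %-parity : ∀ n → ¬ 2 ∣ suc n → n % 2 ≡ 0
    %-parity n 2∤1+n with n % 2 in e | m%n<n n 2
    ... | zero | _ = refl
    ... | suc zero | _ = contradiction
      (m%n≡0⇒n∣m (suc n) 2 (trans (%-distribˡ-+ 1 n 2) (cong (λ r → (1 + r) % 2) e))) 2∤1+n
    ... | suc (suc _) | s≤s (s≤s ())

  ≈ₚ⇒≋ : ∀ (c : CoeffsFp p) {g} → c ≈ₚ g → toPoly c ≋ g
  ≈ₚ⇒≋ c {g} e = coeffs λ k → ≈-trans (≡⇒≈ (e k)) (%-≈ (coeff g k))

  -- The coefficients of `toPoly c` are already reduced, so congruence to those of g is equality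
  -- with their remainders.
  ≋⇒≈ₚ : ∀ (c : CoeffsFp p) {g} → toPoly c ≋ g → c ≈ₚ g
  ≋⇒≈ₚ c (coeffs u) k = trans (sym (m<n⇒m%n≡m
    (coeff-tabulate-< (toℕ ∘ c) (<-trans z<s 2≤p) (λ i → toℕ<n (c i)) k))) (residue≡ (u k))

  toPoly-deg< : ∀ (c : CoeffsFp p) → toPoly c deg< suc (half p)
  toPoly-deg< c = subst (toPoly c deg<_) (length-tabulate (toℕ ∘ c)) (deg<-length (toPoly c))

  coeff-toPoly-half : ∀ (c : CoeffsFp p) → coeff (toPoly c) (half p) ≡ toℕ (c (fromℕ (half p)))
  coeff-toPoly-half c = trans (cong (coeff (toPoly c)) (sym (toℕ-fromℕ (half p))))
    (coeff-tabulate (toℕ ∘ c) (fromℕ (half p)))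

  -- p - a and (p - 1)a are two representatives of -a.
  basePoly≋ : ∀ (a : Fin p) ε → basePoly p a ε ≋ scale ε (pow (X- toℕ a) (half p)) ⊕ (1 ∷ [])
  basePoly≋ a ε = ⊕-congʳ (1 ∷ []) (scale-cong {ε} ≈-refl (pow-cong (half p) (∷-cong p∸a≈-a ≋-refl)))
    where
    p∸a≈-a : p ∸ toℕ a ≈ - toℕ a
    p∸a≈-a = +-cancelˡ≈ (toℕ a) (≈-trans (≡⇒≈ (m+[n∸m]≡n (<⇒≤ (toℕ<n a))))
      (≈-trans p≈0 (≈-sym (+-inverseʳ (toℕ a)))))

  module Characterisation (2<p : 2 < p) (c : CoeffsFp p) where

    private
      m = half p
      p≡ = odd 2<p
      f = toPoly c

    0<m : 0 < m
    0<m = m≥n⇒m/n>0 {p ∸ 1} {2} (s≤s⁻¹ (subst (2 <_) (sym suc[p∸1]≡p) 2<p))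

    open OddCharacteristic m p≡ 0<m hiding (2<p)

    suc[m]<p : suc m < p
    suc[m]<p = subst (suc m <_) (sym p≡) (s≤s (+-monoˡ-≤ m 0<m))

    [p+1]/2≡suc[m] : (p + 1) / 2 ≡ suc m
    [p+1]/2≡suc[m] = trans (cong (_/ 2) (trans (cong (_+ 1) p≡) (lemma m))) (m*n/n≡m (suc m) 2)
      where
      lemma : ∀ m → suc (m + m) + 1 ≡ suc m * 2
      lemma = solve-∀

    suc[m]-half : suc m + suc m ≈ 1
    suc[m]-half = ≈-trans (≡⇒≈ (trans (lemma m) (cong (1 +_) (sym p≡)))) (+-congˡ≈ 1 p≈0)
      where
      lemma : ∀ m → suc m + suc m ≡ 1 + suc (m + m)
      lemma = solve-∀

    half-unique : ∀ {s} → s + s ≈ 1 → s ≈ (p + 1) / 2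
    half-unique {s} 2s≈1 = conclude (*-cancelˡ≈ 2 (begin
      2 * s                ≡⟨ cong (s +_) (+-identityʳ s) ⟩
      s + s                ≈⟨ 2s≈1 ⟩
      1                    ≈⟨ suc[m]-half ⟨
      suc m + suc m        ≡⟨ cong (suc m +_) (+-identityʳ (suc m)) ⟨
      2 * suc m            ∎))
      where
      open ≈-Reasoning
      conclude : 2 ≈ 0 ⊎ s ≈ suc m → s ≈ (p + 1) / 2
      conclude (inj₁ 2≈0) = contradiction 2≈0 (0<·<p⇒≉0 z<s 2<p)
      conclude (inj₂ s≈) = ≈-trans s≈ (≡⇒≈ (sym [p+1]/2≡suc[m]))

    forward : InCalP p c → InRHS p c
    forward (degree , sum≡p) = classify (F.s≈2⊎2s≈1)
      where
      lead≉0 : coeff f m ≉ 0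
      lead≉0 e = degree (<p⇒≡ (toℕ<n (c (fromℕ m))) (<-trans z<s 2≤p)
        (≈-trans (≡⇒≈ (sym (coeff-toPoly-half c))) e))
      f-ode = ode f m p≡ (toPoly-deg< c) sum≡p
      module F = Forward f (toPoly-deg< c) lead≉0 sum≡p f-ode
      open ODE f-ode using (s)
      base : ∀ {a} (a<p : a < p) ε →
        scale ε (pow (X- a) m) ⊕ (1 ∷ []) ≋ basePoly p (fromℕ< a<p) ε
      base a<p ε = ≋-sym (subst (λ n → basePoly p (fromℕ< a<p) ε ≋ scale ε (pow (X- n) m) ⊕ (1 ∷ []))
        (toℕ-fromℕ< a<p) (basePoly≋ (fromℕ< a<p) ε))
      classify : s ≈ 2 ⊎ s + s ≈ 1 → InRHS p c
      classify (inj₁ s≈2) with F.classification₁ s≈2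
      ... | a , a<p , ε , ε-sign , f≋ = inj₁ (fromℕ< a<p , ε , ε-sign ,
        ≋⇒≈ₚ c (≋-trans f≋ (≋-trans (scale-1 _) (base a<p ε))))
      classify (inj₂ 2s≈1) with F.classificationₛ 2s≈1
      ... | a , a<p , ε , ε-sign , f≋ = inj₂ (fromℕ< a<p , ε , ε-sign ,
        ≋⇒≈ₚ c (≋-trans f≋ (scale-cong {s} (half-unique {s} 2s≈1) (base a<p ε))))

    backward : InRHS p c → InCalP p c
    backward (inj₁ (a , ε , ε-sign , c≈)) =
      (λ e → B.coeff-m≉0 (≡⇒≈ (trans (coeff-toPoly-half c) e))) ,
      trans B.sum-values (trans (lemma m) (sym p≡))
      where
      module B = Converse f (toPoly-deg< c) 1 ε (toℕ a) 1 2 ε-sign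
        (≋-trans (≈ₚ⇒≋ c c≈) (≋-trans (basePoly≋ a ε) (≋-sym (scale-1 _))))
        ≈-refl ≈-refl 2≤p 2<p (λ ()) (λ ()) (λ ())
      lemma : ∀ m → 1 + m * 2 ≡ suc (m + m)
      lemma = solve-∀
    backward (inj₂ (a , ε , ε-sign , c≈)) =
      (λ e → B.coeff-m≉0 (≡⇒≈ (trans (coeff-toPoly-half c) e))) ,
      trans B.sum-values (trans (cong (suc m +_) (*-identityʳ m)) (sym p≡))
      where
      module B = Converse f (toPoly-deg< c) ((p + 1) / 2) ε (toℕ a) (suc m) 1 ε-sign
        (≋-trans (≈ₚ⇒≋ c c≈) (scale-cong {(p + 1) / 2} ≈-refl (basePoly≋ a ε)))
        (≡⇒≈ [p+1]/2≡suc[m]) (≈-trans (≡⇒≈ (cong₂ _+_ [p+1]/2≡suc[m] [p+1]/2≡suc[m])) suc[m]-half)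
        -- The values m + 1 and 1 are distinct because m > 0.
        suc[m]<p 2≤p (λ e → <⇒≢ 0<m (sym (suc-injective e))) (λ ()) (λ ())

theorem1p1 : (p : ℕ) .{{_ : NonZero p}} → Prime p → 7408848 < p →
    (c : CoeffsFp p) → InCalP p c ⇔ InRHS p c
theorem1p1 p p-prime large c = mk⇔ forward backward
  where
  open PrimeField p p-prime
  open Characterisation (<-trans (<ᵇ⇒< 2 7408848 tt) large) c
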